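{- Let $r\ge1$, let $\theta_r=\alpha_1+\cdots+\alpha_r$ be the highest root of $\mathfrak{sl}_{r+1}(\mathbb{C})$, let $I\subseteq[r]$ be nonempty with interval partition $I=\bigsqcup_{x=1}^{n(I)}[i_x,j_x]$, and write $I^c=[r]\setminus I$. For an interval $J$ of consecutive integers which is one of the maximal intervals of $I^c$, let $S(J)$ be the set of all (possibly empty) sets $\mathcal{J}$ of pairwise nonconsecutive integers in $J$ such that $\sigma_{\mathcal{J}}:=\prod_{i\in\mathcal{J}}s_i$ lies in $\mathcal{A}_r(\theta_r,\alpha_I)$. Then: \begin{itemize} \item If $1\notin I$ (so $[1,i_1-1]$ is a maximal interval of $I^c$), then \[\sum_{\mathcal{J}\in S([1,i_1-1])}(-1)^{\ell(\sigma_{\mathcal{J}})}\wp_q\Big(\alpha_{1,i_1-1}-\sum_{i\in\mathcal{J}}\alpha_i\Big)=m_q(\theta_{i_1},\alpha_{i_1}),\] where the right-hand side is computed in $\mathfrak{sl}_{i_1+1}(\mathbb{C})$. \item For each $x\in[n(I)-1]$, with $N=i_{x+1}-j_x+1$, \[\sum_{\mathcal{J}\in S([j_x+1,i_{x+1}-1])}(-1)^{\ell(\sigma_{\mathcal{J}})}\wp_q\Big(\alpha_{j_x+1,i_{x+1}-1}-\sum_{i\in\mathcal{J}}\alpha_i\Big)=m_q(\theta_N,\alpha_1+\alpha_N),\] where the right-hand side is computed in $\mathfrak{sl}_{N+1}(\mathbb{C})$. \item If $r\notin I$ (so $[j_{n(I)}+1,r]$ is a maximal interval of $I^c$), then with $N=r-j_{n(I)}+1$,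 \[\sum_{\mathcal{J}\in S([j_{n(I)}+1,r])}(-1)^{\ell(\sigma_{\mathcal{J}})}\wp_q\Big(\alpha_{j_{n(I)}+1,r}-\sum_{i\in\mathcal{J}}\alpha_i\Big)=m_q(\theta_N,\alpha_1),\] where the right-hand side is computed in $\mathfrak{sl}_{N+1}(\mathbb{C})$. \end{itemize}
   Context: Notation: $[n]=\{1,\dots,n\}$, $[a,b]=\{a,\dots,b\}$. For each rank $N\ge1$, in $\mathfrak{sl}_{N+1}(\mathbb{C})$ the simple roots are $\alpha_i=e_i-e_{i+1}$ ($i\in[N]$), the positive roots are $\alpha_{i,j}=\alpha_i+\cdots+\alpha_j$ ($1\le i\le j\le N$), the highest root is $\theta_N=\alpha_{1,N}$, and $\rho_N$ is half the sum of the positive roots; the Weyl group $W\cong\mathfrak{S}_{N+1}$ is generated by simple reflections $s_i$, with length function $\ell$. Kostant's partition function $\wp(\xi)$ counts ways to write $\xi$ as a nonnegative integral sum of positive roots; its $q$-analog is $\wp_q(\xi)=\sum_{k\ge0}c_kq^k$ with $c_k$ the number of ways to write $\xi$ as a sum of exactly $k$ positive roots (unordered, repetition allowed). The Weyl alternation set in rank $N$ is $\mathcal{A}_N(\lambda,\mu)=\{\sigma\in W:\wp(\sigma(\lambda+\rho_N)-\rho_N-\mu)>0\}$, and $m_q(\lambda,\mu)=\sum_{\sigma\in W}(-1)^{\ell(\sigma)}\wp_q(\sigma(\lambda+\rho_N)-\rho_N-\mu)$. For $I\subseteq[r]$, $\alpha_I=\sum_{i\in I}\alpha_i$; the interval partition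 of $I$ is its decomposition into maximal intervals of consecutive integers $[i_1,j_1]\sqcup\cdots\sqcup[i_{n(I)},j_{n(I)}]$ with $j_x+1<i_{x+1}$. The empty product $\prod_{i\in\emptyset}s_i$ is $1$ and the empty sum of roots is $0$. -}

module Defs where

open import Data.Bool using (Bool; true; false; if_then_else_; _∧_)
open import Data.Nat as ℕ using (ℕ; zero; suc; _∸_; _<ᵇ_; _≡ᵇ_)
open import Data.Integer as ℤ using (ℤ; +_; -_; 0ℤ; 1ℤ; ∣_∣)
open import Data.Fin using (Fin; toℕ)
import Data.Fin as F
open import Data.Vec as V using (Vec; tabulate; lookup; zipWith; allFin; insertAt; toList)
open import Data.List as L using (List; []; _∷_; _++_; [_]; concatMap; filterᵇ; upTo; foldr; length)
open import Relation.Nullary.Decidable using (does)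

-- Conventions.  Rank n means sl_{n+1}.  Weights of sl_{n+1} are written
-- in the coordinates of e_1,...,e_{n+1} (0-indexed by Fin (suc n)).
-- Simple roots / indices i are 1-based as in the paper: alpha_i = e_i - e_{i+1}.

Wt : ℕ → Set
Wt n = Vec ℤ (suc n)

zeroW : ∀ {n} → Wt n
zeroW = V.replicate _ 0ℤ

_⊕_ : ∀ {n} → Wt n → Wt n → Wt n
_⊕_ = zipWith ℤ._+_

_⊖_ : ∀ {n} → Wt n → Wt n → Wt n
_⊖_ = zipWith ℤ._-_

scale : ∀ {n} → ℕ → Wt n → Wt n
scale m = V.map (λ z → (+ m) ℤ.* z)

eDiff : ∀ {n} → Fin (suc n) → Fin (suc n) → Wt n
eDiff a b = tabulate λ k →
  if toℕ k ≡ᵇ toℕ a then 1ℤ else (if toℕ k ≡ᵇ toℕ b then - 1ℤ else 0ℤ)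

-- simple root alpha_i (1-based i, meaningful for 1 ≤ i ≤ n)
simpleRoot : (n i : ℕ) → Wt n
simpleRoot n i = tabulate λ k →
  if suc (toℕ k) ≡ᵇ i then 1ℤ else (if toℕ k ≡ᵇ i then - 1ℤ else 0ℤ)

range : ℕ → ℕ → List ℕ
range a b = L.map (a ℕ.+_) (upTo (suc b ∸ a))

alphaList : (n : ℕ) → List ℕ → Wt n
alphaList n is = foldr (λ i v → simpleRoot n i ⊕ v) zeroW is

alphaInterval : (n a b : ℕ) → Wt n
alphaInterval n a b = alphaList n (range a b)

alphaSet : (n : ℕ) → (ℕ → Bool) → Wt n
alphaSet n I = alphaList n (filterᵇ I (range 1 n))

theta : (n : ℕ) → Wt n
theta n = alphaInterval n 1 n

-- rho, shifted by a W-invariant multiple of (1,...,1):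
-- (n, n-1, ..., 0) = rho_n + (n/2)(1,...,1).
rho : (n : ℕ) → Wt n
rho n = tabulate λ k → + (n ∸ toℕ k)

-- Weyl group W = S_{n+1}.  A permutation is stored as a vector w of
-- length n+1 ("one-line notation"); it acts on weights by permuting
-- coordinates: (w · v)_j = v_{w(j)}.

Perm : ℕ → Set
Perm m = Vec (Fin m) m

act : ∀ {n} → Perm (suc n) → Wt n → Wt n
act w v = V.map (lookup v) w

-- product: act (w₁ ⋆ w₂) v = act w₁ (act w₂ v)
_⋆_ : ∀ {m} → Perm m → Perm m → Perm m
w₁ ⋆ w₂ = V.map (lookup w₂) w₁

idPerm : ∀ {m} → Perm m
idPerm = allFin _

allPerms : (m : ℕ) → List (Perm m)
allPerms zero = [ V.[] ]
allPerms (suc m) =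
  concatMap (λ p → L.map (λ i → insertAt (V.map F.suc p) i F.zero) (L.allFin (suc m)))
            (allPerms m)

-- clamped ℕ → Fin (only used in range)
natFin : ∀ {m} → ℕ → Fin (suc m)
natFin {m} zero = F.zero
natFin {zero} (suc k) = F.zero
natFin {suc m} (suc k) = F.suc (natFin {m} k)

-- simple reflection s_i (1-based, 1 ≤ i ≤ n) in W(sl_{n+1}): swaps e_i, e_{i+1}
sRefl : (n i : ℕ) → Perm (suc n)
sRefl n i = tabulate λ k →
  if toℕ k ≡ᵇ (i ∸ 1) then natFin i
  else (if toℕ k ≡ᵇ i then natFin (i ∸ 1) else k)

prodRefl : (n : ℕ) → List ℕ → Perm (suc n)
prodRefl n is = foldr (λ i w → sRefl n i ⋆ w) idPerm is

inversions : List ℕ → ℕ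
inversions [] = 0
inversions (x ∷ xs) = length (filterᵇ (λ y → y <ᵇ x) xs) ℕ.+ inversions xs

-- Coxeter length ℓ(w) = number of inversions
len : ∀ {m} → Perm m → ℕ
len w = inversions (toList (V.map toℕ w))

sgn : ℕ → ℤ
sgn zero = 1ℤ
sgn (suc k) = - sgn k

posRoots : (n : ℕ) → List (Wt n)
posRoots n = concatMap (λ a → concatMap (λ b →
    if toℕ a <ᵇ toℕ b then [ eDiff a b ] else []) (L.allFin (suc n)))
  (L.allFin (suc n))

isZeroW : ∀ {n} → Wt n → Bool
isZeroW v = foldr (λ z b → does (z ℤ.≟ 0ℤ) ∧ b) true (toList v)

sumℕ : List ℕ → ℕ
sumℕ = foldr ℕ._+_ 0

sumℤ : List ℤ → ℤ
sumℤ = foldr ℤ._+_ 0ℤ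

countDecomp : ∀ {n} → List (Wt n) → Wt n → ℕ → ℕ
countDecomp [] ξ k = if isZeroW ξ ∧ (k ≡ᵇ 0) then 1 else 0
countDecomp (β ∷ βs) ξ k =
  sumℕ (L.map (λ m → countDecomp βs (ξ ⊖ scale m β) (k ∸ m)) (upTo (suc k)))

-- c_k(ξ): coefficient of q^k in ℘_q(ξ) (rank n)
qKostant : (n : ℕ) → Wt n → ℕ → ℕ
qKostant n ξ k = countDecomp (posRoots n) ξ k

-- a bound on the number of roots in any decomposition of ξ
-- (any decomposition into k positive roots has k ≤ height ξ ≤ this)
htBound : ∀ {n} → Wt n → ℕ
htBound {n} ξ = sumℕ (L.map (λ j → toℕ j ℕ.* ∣ lookup ξ j ∣) (L.allFin (suc n)))

kostant : (n : ℕ) → Wt n → ℕ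
kostant n ξ = sumℕ (L.map (qKostant n ξ) (upTo (suc (htBound ξ))))

dotArg : (n : ℕ) → Perm (suc n) → Wt n → Wt n → Wt n
dotArg n σ λ' μ = (act σ (λ' ⊕ rho n) ⊖ rho n) ⊖ μ

inAlt : (n : ℕ) → Perm (suc n) → Wt n → Wt n → Bool
inAlt n σ λ' μ = 0 <ᵇ kostant n (dotArg n σ λ' μ)

-- coefficient of q^k in m_q(λ, μ), rank n
mq : (n : ℕ) → Wt n → Wt n → ℕ → ℤ
mq n λ' μ k = sumℤ (L.map (λ σ → sgn (len σ) ℤ.* (+ qKostant n (dotArg n σ λ' μ) k))
                           (allPerms (suc n)))

sublists : List ℕ → List (List ℕ)
sublists [] = [ [] ]
sublists (x ∷ xs) = sublists xs ++ L.map (x ∷_) (sublists xs)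

-- for an increasing list: no two consecutive integers
noConsec : List ℕ → Bool
noConsec (x ∷ y ∷ ys) = (suc x <ᵇ y) ∧ noConsec (y ∷ ys)
noConsec _ = true

S : (r : ℕ) → (ℕ → Bool) → ℕ → ℕ → List (List ℕ)
S r I a b = filterᵇ (λ J → inAlt r (prodRefl r J) (theta r) (alphaSet r I))
                    (filterᵇ noConsec (sublists (range a b)))

-- coefficient of q^k in
--   Σ_{𝒥 ∈ S([a,b])} (-1)^{ℓ(σ_𝒥)} ℘_q(α_{a,b} - Σ_{i∈𝒥} α_i)   (rank r)
lhs : (r : ℕ) → (ℕ → Bool) → ℕ → ℕ → ℕ → ℤ
lhs r I a b k = sumℤ (L.map (λ J → sgn (len (prodRefl r J)) ℤ.*
                          (+ qKostant r (alphaInterval r a b ⊖ alphaList r J) k))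
                       (S r I a b))

{-# OPTIONS --safe #-}

-- In rank N, θ + ρ = (N + 1, N − 1, …, 1, −1), and its partial sums of length 1, …, N exceed
-- those of ρ by exactly 1.  A weight with nonzero partition function has nonnegative partial
-- sums, and so has μ; hence σ(θ + ρ) − ρ has nonnegative partial sums.  This forces σ to fix
-- both ends and, in between, to fall behind by at most one at any time and to recover at once:
-- σ is a product of reflections s_i over a set of nonconsecutive i in [2, N − 1], that is, a
-- tiling of N − 1 cells by monominoes and dominoes, and then σ(θ + ρ) − ρ = θ − Σ α_i.
-- In rank r, a nonconsecutive 𝒥 ⊆ I^c gives an element of the alternation set exactly when it
-- avoids 1 and r, so S(J) is indexed by the same tilings.  The terms agree because the partition
-- function does not see zero coordinates at either end of a weight.
module Submission where

open import Defs
open import Data.Bool using (Bool; true; false; if_then_else_; _∧_; not; T)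
open import Data.Nat as ℕ using (ℕ; zero; suc; _+_; _∸_; _≤_; _<_; z≤n; s≤s; _≡ᵇ_; _<ᵇ_)
import Data.Nat.Properties as ℕₚ
open import Data.Integer as ℤ using (ℤ; +_; -_; 0ℤ; 1ℤ; -1ℤ; ∣_∣; +≤+; -≤+)
import Data.Integer.Properties as ℤₚ
import Data.Integer.Tactic.RingSolver as ℤ-Solver
open import Data.Fin using (Fin; toℕ)
import Data.Fin as F
import Data.Fin.Properties as Fₚ
open import Data.List as L using (List; []; _∷_; _++_; [_]; concatMap; filterᵇ; upTo; foldr; length)
import Data.List.Properties as Lₚ
open import Data.List.Relation.Unary.All as All using (All; []; _∷_)
import Data.List.Relation.Unary.All.Properties as Allₚ
open import Data.List.Membership.Propositional using (_∈_)
import Data.List.Membership.Propositional.Properties as ∈ₚ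
open import Data.List.Relation.Unary.Any as Any using (here; there)
open import Data.List.Relation.Binary.Sublist.Propositional using (_⊆_; []; _∷_; _∷ʳ_; ⊆-trans; ⊆-refl)
import Data.List.Relation.Binary.Sublist.Propositional.Properties as Subₚ
open import Data.Vec as V using (Vec; []; _∷_; tabulate; lookup; insertAt; toList; zipWith)
import Data.Vec.Properties as Vₚ
open import Data.Product using (_×_; _,_; ∃; proj₁; proj₂)
open import Data.Sum using (_⊎_; inj₁; inj₂)
open import Data.Unit using (⊤; tt)
open import Data.Empty using (⊥)
open import Function using (_∘_; id)
open import Relation.Nullary using (¬_; yes; no; does; contradiction)
open import Relation.Binary.PropositionalEquality
  using (_≡_; _≢_; _≗_; refl; sym; trans; cong; cong₂; subst; module ≡-Reasoning)

-- The two sides meet the alternation set in opposite ways. On the right, σ runs over the whole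
-- group and only the vanishing of terms off the tilings matters; a tiling with coefficient 0 may
-- stay in the sum. On the left, S(J) filters by `inAlt`, so each nonconsecutive sublist needs a
-- definite verdict: a decomposition into simple roots is exhibited for inner sets, and a linear
-- functional rules out those that contain 1 or r. Every vanishing statement rests on one principle:
-- a functional that is nonnegative on all positive roots is nonnegative on any weight that has a
-- decomposition. Partial sums, the first coordinate and minus the last coordinate are such
-- functionals. The recursion over the group follows `allPerms`, which inserts the value 0 into a
-- smaller permutation. The position of 0 is the place to which the largest coordinate goes, so the
-- tiling is read off from its first tile.

private variable
  A B : Set

-- Finite sums and coordinates of weights

∑ : List A → (A → ℤ) → ℤ
∑ xs f = sumℤ (L.map f xs)

∑-cong : {f g : A → ℤ} (xs : List A) → f ≗ g → ∑ xs f ≡ ∑ xs g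
∑-cong xs e = cong sumℤ (Lₚ.map-cong e xs)

∑-zero : {f : A → ℤ} (xs : List A) → (∀ x → f x ≡ 0ℤ) → ∑ xs f ≡ 0ℤ
∑-zero [] e = refl
∑-zero (x ∷ xs) e rewrite e x = trans (ℤₚ.+-identityˡ _) (∑-zero xs e)

∑-++ : (f : A → ℤ) (xs ys : List A) → ∑ (xs ++ ys) f ≡ ∑ xs f ℤ.+ ∑ ys f
∑-++ f [] ys = sym (ℤₚ.+-identityˡ _)
∑-++ f (x ∷ xs) ys = trans (cong (ℤ._+_ (f x)) (∑-++ f xs ys)) (sym (ℤₚ.+-assoc (f x) _ _))

∑-map : (f : B → ℤ) (g : A → B) (xs : List A) → ∑ (L.map g xs) f ≡ ∑ xs (f ∘ g)
∑-map f g xs = cong sumℤ (sym (Lₚ.map-∘ xs))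

∑-concatMap : (f : B → ℤ) (g : A → List B) (xs : List A) →
  ∑ (concatMap g xs) f ≡ ∑ xs (λ x → ∑ (g x) f)
∑-concatMap f g [] = refl
∑-concatMap f g (x ∷ xs) =
  trans (∑-++ f (g x) (concatMap g xs)) (cong (ℤ._+_ (∑ (g x) f)) (∑-concatMap f g xs))

+-interchange : ∀ a b c d → (a ℤ.+ b) ℤ.+ (c ℤ.+ d) ≡ (a ℤ.+ c) ℤ.+ (b ℤ.+ d)
+-interchange = ℤ-Solver.solve-∀

∑-+ : (f g : A → ℤ) (xs : List A) → ∑ xs (λ x → f x ℤ.+ g x) ≡ ∑ xs f ℤ.+ ∑ xs g
∑-+ f g [] = refl
∑-+ f g (x ∷ xs) = trans (cong (ℤ._+_ (f x ℤ.+ g x)) (∑-+ f g xs)) (+-interchange (f x) (g x) _ _)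

∑-filterᵇ : (p : A → Bool) (f : A → ℤ) (xs : List A) →
  ∑ (filterᵇ p xs) f ≡ ∑ xs (λ x → if p x then f x else 0ℤ)
∑-filterᵇ p f [] = refl
∑-filterᵇ p f (x ∷ xs) with p x
... | true  = cong (ℤ._+_ (f x)) (∑-filterᵇ p f xs)
... | false = trans (∑-filterᵇ p f xs) (sym (ℤₚ.+-identityˡ _))

-- Rank n weights have n + 1 coordinates, so they are written wt (suc n) f.
wt : ∀ m → (ℕ → ℤ) → Vec ℤ m
wt m f = tabulate (f ∘ toℕ)

wt-cong : ∀ m {f g : ℕ → ℤ} → (∀ t → t < m → f t ≡ g t) → wt m f ≡ wt m g
wt-cong m e = Vₚ.tabulate-cong (λ k → e (toℕ k) (Fₚ.toℕ<n k))

wt-⊕ : ∀ m (f g : ℕ → ℤ) → zipWith ℤ._+_ (wt m f) (wt m g) ≡ wt m (λ t → f t ℤ.+ g t)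
wt-⊕ zero f g = refl
wt-⊕ (suc m) f g = cong (f 0 ℤ.+ g 0 ∷_) (wt-⊕ m (f ∘ suc) (g ∘ suc))

wt-⊖ : ∀ m (f g : ℕ → ℤ) → zipWith ℤ._-_ (wt m f) (wt m g) ≡ wt m (λ t → f t ℤ.- g t)
wt-⊖ zero f g = refl
wt-⊖ (suc m) f g = cong (f 0 ℤ.- g 0 ∷_) (wt-⊖ m (f ∘ suc) (g ∘ suc))

wt-zero : ∀ m → V.replicate m 0ℤ ≡ wt m (λ _ → 0ℤ)
wt-zero zero = refl
wt-zero (suc m) = cong (0ℤ ∷_) (wt-zero m)

-- The index `i` is 1-based and the coordinate `t` is 0-based. No rank occurs, so one function
-- describes the root in every rank; the comparison of ranks r and N relies on this.
simpleCoord : ℕ → ℕ → ℤ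
simpleCoord i t = if suc t ≡ᵇ i then 1ℤ else (if t ≡ᵇ i then - 1ℤ else 0ℤ)

alphaCoord : List ℕ → ℕ → ℤ
alphaCoord [] t = 0ℤ
alphaCoord (i ∷ is) t = simpleCoord i t ℤ.+ alphaCoord is t

alphaList-wt : ∀ n is → alphaList n is ≡ wt (suc n) (alphaCoord is)
alphaList-wt n [] = wt-zero (suc n)
alphaList-wt n (i ∷ is) =
  trans (cong (simpleRoot n i ⊕_) (alphaList-wt n is)) (wt-⊕ (suc n) (simpleCoord i) (alphaCoord is))

≡ᵇ-refl : ∀ n → (n ≡ᵇ n) ≡ true
≡ᵇ-refl zero = refl
≡ᵇ-refl (suc n) = ≡ᵇ-refl n

≢⇒≡ᵇ-false : ∀ m n → m ≢ n → (m ≡ᵇ n) ≡ false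
≢⇒≡ᵇ-false zero zero h = contradiction refl h
≢⇒≡ᵇ-false zero (suc n) h = refl
≢⇒≡ᵇ-false (suc m) zero h = refl
≢⇒≡ᵇ-false (suc m) (suc n) h = ≢⇒≡ᵇ-false m n (h ∘ cong suc)

simpleCoord-below : ∀ i t → suc t < i → simpleCoord i t ≡ 0ℤ
simpleCoord-below i t h rewrite ≢⇒≡ᵇ-false (suc t) i (ℕₚ.<⇒≢ h) | ≢⇒≡ᵇ-false t i
  (ℕₚ.<⇒≢ (ℕₚ.<-trans (ℕₚ.n<1+n t) h)) = refl

simpleCoord-above : ∀ i t → i < t → simpleCoord i t ≡ 0ℤ
simpleCoord-above i t h rewrite ≢⇒≡ᵇ-false (suc t) i (ℕₚ.<⇒≢ (ℕₚ.m<n⇒m<1+n h) ∘ sym) | ≢⇒≡ᵇ-false t i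
  (ℕₚ.<⇒≢ h ∘ sym) = refl

simpleCoord-+ : ∀ p i t → simpleCoord (p + i) (p + t) ≡ simpleCoord i t
simpleCoord-+ zero i t = refl
simpleCoord-+ (suc p) i t = simpleCoord-+ p i t

alphaCoord-++ : ∀ is js t → alphaCoord (is ++ js) t ≡ alphaCoord is t ℤ.+ alphaCoord js t
alphaCoord-++ [] js t = sym (ℤₚ.+-identityˡ _)
alphaCoord-++ (i ∷ is) js t = trans (cong (ℤ._+_ (simpleCoord i t)) (alphaCoord-++ is js t))
  (sym (ℤₚ.+-assoc (simpleCoord i t) _ _))

alphaCoord-below : ∀ {t} is → All (suc t <_) is → alphaCoord is t ≡ 0ℤ
alphaCoord-below [] [] = refl
alphaCoord-below {t} (i ∷ is) (h ∷ hs) rewrite simpleCoord-below i t h | alphaCoord-below is hs = refl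

alphaCoord-above : ∀ {t} is → All (_< t) is → alphaCoord is t ≡ 0ℤ
alphaCoord-above [] [] = refl
alphaCoord-above {t} (i ∷ is) (h ∷ hs) rewrite simpleCoord-above i t h | alphaCoord-above is hs = refl

alphaCoord-map-+ : ∀ p is t → alphaCoord (L.map (p ℕ.+_) is) (p + t) ≡ alphaCoord is t
alphaCoord-map-+ p [] t = refl
alphaCoord-map-+ p (i ∷ is) t = cong₂ ℤ._+_ (simpleCoord-+ p i t) (alphaCoord-map-+ p is t)

-- Combinatorics of tilings

data Tiling : ℕ → Set where
  nil  : Tiling 0
  mono : ∀ {m} → Tiling m → Tiling (suc m)
  domino : ∀ {m} → Tiling m → Tiling (suc (suc m))

-- Recursion on the first tile, the form in which both sums arrive: by the position of the value 0
-- in a permutation, and by the least element of an interval.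
∑Tiling : ∀ m → (Tiling m → ℤ) → ℤ
∑Tiling 0 h = h nil
∑Tiling 1 h = h (mono nil)
∑Tiling (suc (suc m)) h = ∑Tiling (suc m) (h ∘ mono) ℤ.+ ∑Tiling m (h ∘ domino)

∑Tiling-cong : ∀ m {h h' : Tiling m → ℤ} → h ≗ h' → ∑Tiling m h ≡ ∑Tiling m h'
∑Tiling-cong 0 e = e nil
∑Tiling-cong 1 e = e (mono nil)
∑Tiling-cong (suc (suc m)) e = cong₂ ℤ._+_ (∑Tiling-cong (suc m) (e ∘ mono)) (∑Tiling-cong m (e ∘ domino))

dominoes : ∀ {m} → Tiling m → ℕ
dominoes nil = 0
dominoes (mono T) = dominoes T
dominoes (domino T) = suc (dominoes T)

-- A domino covering the (0-indexed) cells s and s+1 stands for the reflection s_{s+1}.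
refls : ∀ {m} → ℕ → Tiling m → List ℕ
refls s nil = []
refls s (mono T) = refls (suc s) T
refls s (domino T) = suc s ∷ refls (suc (suc s)) T

refls-suc : ∀ {m} s (T : Tiling m) → refls (suc s) T ≡ L.map suc (refls s T)
refls-suc s nil = refl
refls-suc s (mono T) = refls-suc (suc s) T
refls-suc s (domino T) = cong (suc (suc s) ∷_) (refls-suc (suc (suc s)) T)

refls-+ : ∀ {m} p s (T : Tiling m) → refls (p + s) T ≡ L.map (p ℕ.+_) (refls s T)
refls-+ zero s T = sym (Lₚ.map-id _)
refls-+ (suc p) s T = trans (refls-suc (p + s) T) (trans (cong (L.map suc) (refls-+ p s T))
  (sym (Lₚ.map-∘ (refls s T))))

refls-bounds : ∀ {m} s (T : Tiling m) → All (λ i → s < i × i < s + m) (refls s T)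
refls-bounds s nil = []
refls-bounds {suc m} s (mono T) = All.map
  (λ { {i} (a , b) → ℕₚ.<-trans (ℕₚ.n<1+n s) a , subst (i <_) (sym (ℕₚ.+-suc s m)) b }) (refls-bounds (suc s) T)
refls-bounds {suc (suc m)} s (domino T) = (ℕₚ.n<1+n s , subst (suc s <_) (sym e) (s≤s (s≤s (ℕₚ.m≤m+n s m)))) ∷
  All.map
  (λ { {i} (a , b) → ℕₚ.<-trans (s≤s (ℕₚ.n≤1+n s)) a , subst (i <_) (sym e) b }) (refls-bounds (suc (suc s)) T)
  where e : s + suc (suc m) ≡ suc (suc (s + m))
        e = trans (ℕₚ.+-suc s (suc m)) (cong suc (ℕₚ.+-suc s m))

shift : ∀ {m} → Perm m → Perm (suc m)
shift p = F.zero ∷ V.map F.suc p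

swapShift : ∀ {m} → Perm m → Perm (suc (suc m))
swapShift p = F.suc F.zero ∷ F.zero ∷ V.map F.suc (V.map F.suc p)

-- There is one entry more than there are cells: the last one, which carries the coordinate -1 of
-- `tailWeight`, never moves.
tilingPerm : ∀ {m} → Tiling m → Perm (suc m)
tilingPerm nil = F.zero ∷ []
tilingPerm (mono T) = shift (tilingPerm T)
tilingPerm (domino T) = swapShift (tilingPerm T)

oneLine : ∀ {m k} → Vec (Fin m) k → List ℕ
oneLine w = toList (V.map toℕ w)

oneLine-suc : ∀ {m k} (w : Vec (Fin m) k) → oneLine (V.map F.suc w) ≡ L.map suc (oneLine w)
oneLine-suc [] = refl
oneLine-suc (x ∷ w) = cong (suc (toℕ x) ∷_) (oneLine-suc w)

length-filterᵇ-none : ∀ (p : ℕ → Bool) xs → (∀ y → p (suc y) ≡ false) → length (filterᵇ p (L.map suc xs)) ≡ 0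
length-filterᵇ-none p [] h = refl
length-filterᵇ-none p (x ∷ xs) h rewrite h x = length-filterᵇ-none p xs h

length-filterᵇ-suc : ∀ x xs → length (filterᵇ (_<ᵇ suc x) (L.map suc xs)) ≡ length (filterᵇ (_<ᵇ x) xs)
length-filterᵇ-suc x [] = refl
length-filterᵇ-suc x (y ∷ xs) with y <ᵇ x
... | true = cong suc (length-filterᵇ-suc x xs)
... | false = length-filterᵇ-suc x xs

inversions-suc : ∀ xs → inversions (L.map suc xs) ≡ inversions xs
inversions-suc [] = refl
inversions-suc (x ∷ xs) = cong₂ _+_ (length-filterᵇ-suc x xs) (inversions-suc xs)

len-shift : ∀ {m} (p : Perm m) → len (shift p) ≡ len p
len-shift p rewrite oneLine-suc p = cong₂ _+_ (length-filterᵇ-none (_<ᵇ 0) (oneLine p) (λ _ → refl))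
  (inversions-suc (oneLine p))

len-swapShift : ∀ {m} (p : Perm m) → len (swapShift p) ≡ suc (len p)
len-swapShift p rewrite oneLine-suc (V.map F.suc p) | oneLine-suc p =
  cong suc (cong₂ _+_ (length-filterᵇ-none (_<ᵇ 1) (L.map suc (oneLine p)) (λ _ → refl))
    (trans (cong₂ _+_ (length-filterᵇ-none (_<ᵇ 0) (L.map suc (oneLine p)) (λ _ → refl)) refl)
      (trans (inversions-suc (L.map suc (oneLine p))) (inversions-suc (oneLine p)))))

len-tilingPerm : ∀ {m} (T : Tiling m) → len (tilingPerm T) ≡ dominoes T
len-tilingPerm nil = refl
len-tilingPerm (mono T) = trans (len-shift (tilingPerm T)) (len-tilingPerm T)
len-tilingPerm (domino T) = trans (len-swapShift (tilingPerm T)) (cong suc (len-tilingPerm T))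

-- Reduction of the sum over the Weyl group to tilings

-- All nonempty partial sums stay nonnegative when the running total starts at b.
PartialSums≥0 : ∀ {m} → ℤ → Vec ℤ m → Set
PartialSums≥0 b [] = ⊤
PartialSums≥0 b (x ∷ v) = (0ℤ ℤ.≤ b ℤ.+ x) × PartialSums≥0 (b ℤ.+ x) v

-- θ + ρ in rank m + 1 without its first coordinate m + 2, i.e. (m, …, 1, −1).
tailCoord : ℕ → ℕ → ℤ
tailCoord zero _ = -1ℤ
tailCoord (suc m) zero = + suc m
tailCoord (suc m) (suc t) = tailCoord m t

tailWeight : ∀ m → Wt m
tailWeight m = wt (suc m) (tailCoord m)

<0⇒≱0 : ∀ {x} → x ℤ.< 0ℤ → 0ℤ ℤ.≤ x → ⊥
<0⇒≱0 h h' = ℤₚ.<⇒≱ h h'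

lookup-tailWeight≤ : ∀ m q → lookup (tailWeight m) q ℤ.≤ + m
lookup-tailWeight≤ zero F.zero = -≤+
lookup-tailWeight≤ (suc m) F.zero = ℤₚ.≤-refl
lookup-tailWeight≤ (suc m) (F.suc q) = ℤₚ.≤-trans (lookup-tailWeight≤ m q) (+≤+ (ℕₚ.n≤1+n m))

act-shift : ∀ {m} (p : Perm (suc m)) x (v : Wt m) → act (shift p) (x ∷ v) ≡ x ∷ act p v
act-shift p x v = cong (x ∷_) (sym (Vₚ.map-∘ (lookup (x ∷ v)) F.suc p))

act-swapShift : ∀ {m} (p : Perm (suc m)) x y (v : Wt m) → act (swapShift p) (x ∷ y ∷ v) ≡ y ∷ x ∷ act p v
act-swapShift p x y v = cong (λ w → y ∷ x ∷ w)
  (trans (sym (Vₚ.map-∘ (lookup (x ∷ y ∷ v)) F.suc (V.map F.suc p))) (sym (Vₚ.map-∘ (lookup (y ∷ v)) F.suc p)))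

-- A budget `k` cannot pay for a drop from k + a + 1 to at most a: the total is at most -1.
neg-drop : ∀ a k x → x ℤ.≤ + a → (+ k) ℤ.+ (x ℤ.- + (suc (k + a))) ℤ.< 0ℤ
neg-drop a k x h = ℤₚ.≤-<-trans (ℤₚ.+-monoʳ-≤ (+ k) (ℤₚ.+-monoˡ-≤ (- + suc (k + a)) h)) (subst (ℤ._< 0ℤ) (sym e)
  ℤ.-<+)
  where
  e : (+ k) ℤ.+ (+ a ℤ.- + (suc (k + a))) ≡ -1ℤ
  e = trans (cong (λ z → (+ k) ℤ.+ (+ a ℤ.- z)) (trans (ℤₚ.pos-+ 1 (k + a)) (cong (ℤ._+_ 1ℤ) (ℤₚ.pos-+ k a))))
    (alg (+ k) (+ a))
    where
    alg : ∀ x y → x ℤ.+ (y ℤ.- (1ℤ ℤ.+ (x ℤ.+ y))) ≡ -1ℤ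
    alg = ℤ-Solver.solve-∀

insertZero : ∀ {m} → Perm m → Fin (suc m) → Perm (suc m)
insertZero p i = insertAt (V.map F.suc p) i F.zero

∑-tabulate-zero : ∀ {n} (g : Fin n → A) (f : A → ℤ) → (∀ i → f (g i) ≡ 0ℤ) → ∑ (L.tabulate g) f ≡ 0ℤ
∑-tabulate-zero {n = zero} g f h = refl
∑-tabulate-zero {n = suc n} g f h = cong₂ ℤ._+_ (h F.zero) (∑-tabulate-zero (g ∘ F.suc) f (h ∘ F.suc))

-- The sum splits by the position of the value 0, that is, by where the first coordinate of a weight
-- is sent.
∑-allPerms : ∀ m (G : Perm (suc m) → ℤ) →
  ∑ (allPerms (suc m)) G ≡ ∑ (allPerms m) (λ p → ∑ (L.allFin (suc m)) (λ i → G (insertZero p i)))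
∑-allPerms m G = trans
  (∑-concatMap G (λ p → L.map (insertZero p) (L.allFin (suc m))) (allPerms m))
  (∑-cong (allPerms m) (λ p → ∑-map G (insertZero p) (L.allFin (suc m))))

-- The budget 1 is the partial sum left over once the first coordinate of `θ + ρ`, which is one
-- above that of `ρ`, has stayed in place.
Supported : ∀ m → (Perm (suc m) → ℤ) → Set
Supported m F = ∀ p → ¬ PartialSums≥0 1ℤ (act p (tailWeight m) ⊖ rho m) → F p ≡ 0ℤ

cancel : ∀ b x → b ℤ.+ (x ℤ.- x) ≡ b
cancel = ℤ-Solver.solve-∀

Supported-shift : ∀ m F → Supported (suc m) F → Supported m (F ∘ shift)
Supported-shift m F h p nd = h (shift p) λ d → nd (g d)
  where
  g : PartialSums≥0 1ℤ (act (shift p) (tailWeight (suc m)) ⊖ rho (suc m)) → PartialSums≥0 1ℤ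
    (act p (tailWeight m) ⊖ rho m)
  g d = subst (λ b → PartialSums≥0 b (act p (tailWeight m) ⊖ rho m)) (cancel 1ℤ (+ suc m))
    (proj₂ (subst (λ v → PartialSums≥0 1ℤ (v ⊖ rho (suc m))) (act-shift p (+ suc m) (tailWeight m)) d))

swap-cancel : ∀ b x → b ℤ.+ (x ℤ.- (1ℤ ℤ.+ x)) ℤ.+ ((1ℤ ℤ.+ x) ℤ.- x) ≡ b
swap-cancel = ℤ-Solver.solve-∀

-- A swap at the head spends the whole budget at the first position and earns it back at the second:
-- 1, then 0, then 1 again.
Supported-swapShift : ∀ m F → Supported (suc (suc m)) F → Supported m (F ∘ swapShift)
Supported-swapShift m F h p nd = h (swapShift p) λ d → nd (g d)
  where
  g : PartialSums≥0 1ℤ (act (swapShift p) (tailWeight (suc (suc m))) ⊖ rho (suc (suc m))) → PartialSums≥0 1ℤ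
    (act p (tailWeight m) ⊖ rho m)
  g d = subst (λ b → PartialSums≥0 b (act p (tailWeight m) ⊖ rho m)) (swap-cancel 1ℤ (+ suc m))
    (proj₂ (proj₂ (subst (λ v → PartialSums≥0 1ℤ (v ⊖ rho (suc (suc m)))) (act-swapShift p (+ suc (suc m))
      (+ suc m) (tailWeight m)) d)))

-- With a budget of 1, the value 0 sits in position 0, or in position 1 behind the value 1; any
-- other placement overdraws the budget within the first two positions.
∑-allPerms≡∑Tiling : ∀ m (F : Perm (suc m) → ℤ) → Supported m F → ∑ (allPerms (suc m)) F ≡ ∑Tiling m
  (F ∘ tilingPerm)
∑-allPerms≡∑Tiling zero F h = ℤₚ.+-identityʳ _
-- The only other permutation of two entries puts -1 in front, and 1 + (-1 - 1) is negative. So the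
-- last two entries are never swapped.
∑-allPerms≡∑Tiling (suc zero) F h =
  trans (cong (ℤ._+_ (F (shift (F.zero ∷ [])))) (trans (ℤₚ.+-identityʳ _) (h _ (λ { (() , _) }))))
    (ℤₚ.+-identityʳ _)
∑-allPerms≡∑Tiling (suc (suc m)) F h = begin
  ∑ (allPerms (suc (suc (suc m)))) F
    ≡⟨ ∑-allPerms (suc (suc m)) F ⟩
  ∑ (allPerms (suc (suc m))) (λ p → F (shift p) ℤ.+ moved p)
    ≡⟨ ∑-+ (F ∘ shift) moved (allPerms (suc (suc m))) ⟩
  ∑ (allPerms (suc (suc m))) (F ∘ shift) ℤ.+ ∑ (allPerms (suc (suc m))) moved
    ≡⟨ cong₂ ℤ._+_ (∑-allPerms≡∑Tiling (suc m) (F ∘ shift) (Supported-shift (suc m) F h)) ∑moved ⟩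
  ∑Tiling (suc (suc m)) (F ∘ tilingPerm) ∎
  where
  open ≡-Reasoning
  moved : Perm (suc (suc m)) → ℤ
  moved p = ∑ (L.tabulate F.suc) (F ∘ insertZero p)

  head≥2 : ∀ q (w : Vec _ _) → F (F.suc (F.suc q) ∷ w) ≡ 0ℤ
  head≥2 q w = h _ λ d → <0⇒≱0
    (neg-drop m 1 (lookup (tailWeight m) q) (lookup-tailWeight≤ m q)) (proj₁ d)

  second≥2 : ∀ q (w : Vec _ _) → F (F.suc F.zero ∷ F.suc (F.suc q) ∷ w) ≡ 0ℤ
  second≥2 q w = h _ λ d → <0⇒≱0
    (subst (λ b → b ℤ.+ (lookup (tailWeight m) q ℤ.- + suc m) ℤ.< 0ℤ) (sym (budget (+ suc m))) (neg-drop m 0 _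
      (lookup-tailWeight≤ m q)))
    (proj₁ (proj₂ d))
    where
    budget : ∀ x → 1ℤ ℤ.+ (x ℤ.- (1ℤ ℤ.+ x)) ≡ 0ℤ
    budget = ℤ-Solver.solve-∀

  -- Unfolding `allPerms` once more locates the value 1. Here it stands first, so the value 0 has to
  -- come directly behind it.
  moved-0 : ∀ p → moved (insertZero p F.zero) ≡ F (swapShift p)
  moved-0 p@(x ∷ w) = trans
    (cong (ℤ._+_ (F (swapShift p))) (∑-tabulate-zero (F.suc ∘ F.suc) (F ∘ insertZero (insertZero p F.zero))
      (λ i → second≥2 x (insertAt (V.map F.suc (V.map F.suc w)) i F.zero))))
    (ℤₚ.+-identityʳ _)

  -- Neither 0 nor 1 stands first.
  moved-suc : ∀ p i → moved (insertZero p (F.suc i)) ≡ 0ℤ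
  moved-suc p@(x ∷ w) i = ∑-tabulate-zero F.suc (F ∘ insertZero (insertZero p (F.suc i)))
    (λ j → head≥2 x (insertAt (V.map F.suc (insertAt (V.map F.suc w) i F.zero)) j F.zero))

  ∑moved : ∑ (allPerms (suc (suc m))) moved ≡ ∑Tiling m (F ∘ swapShift ∘ tilingPerm)
  ∑moved = begin
    ∑ (allPerms (suc (suc m))) moved
      ≡⟨ ∑-allPerms (suc m) moved ⟩
    ∑ (allPerms (suc m)) (λ p → moved (insertZero p F.zero) ℤ.+ ∑ (L.tabulate F.suc) (moved ∘ insertZero p))
      ≡⟨ ∑-cong (allPerms (suc m)) (λ p → trans (cong₂ ℤ._+_ (moved-0 p)
           (∑-tabulate-zero F.suc (moved ∘ insertZero p) (moved-suc p))) (ℤₚ.+-identityʳ _)) ⟩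
    ∑ (allPerms (suc m)) (F ∘ swapShift)
      ≡⟨ ∑-allPerms≡∑Tiling m (F ∘ swapShift) (Supported-swapShift m F h) ⟩
    ∑Tiling m (F ∘ swapShift ∘ tilingPerm) ∎

-- A domino swaps coordinates c + 1 and c, which amounts to subtracting the simple root. The gap of
-- 2 between the final coordinates 1 and -1 is out of reach of the dominoes.
act-tilingPerm : ∀ {m} (T : Tiling m) → act (tilingPerm T) (tailWeight m) ≡ wt (suc m) (λ t → tailCoord m t ℤ.-
  alphaCoord (refls 0 T) t)
act-tilingPerm nil = refl
act-tilingPerm {suc m} (mono T) = trans (act-shift (tilingPerm T) (+ suc m) (tailWeight m)) (cong₂ _∷_
  (sym (trans (cong (ℤ._-_ (+ suc m)) (alphaCoord-below (refls 1 T) (All.map proj₁ (refls-bounds 1 T))))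
    (ℤₚ.+-identityʳ _)))
  (trans (act-tilingPerm T) (wt-cong (suc m) λ t _ → cong (ℤ._-_ (tailCoord m t))
    (sym (trans (cong (λ J → alphaCoord J (suc t)) (refls-suc 0 T)) (alphaCoord-map-+ 1 (refls 0 T) t))))))
act-tilingPerm {suc (suc m)} (domino T) = trans (act-swapShift (tilingPerm T) (+ suc (suc m)) (+ suc m)
  (tailWeight m)) (cong₂ _∷_
  (cong (ℤ._-_ (+ suc (suc m))) (sym (cong (ℤ._+_ 1ℤ) (alphaCoord-below (refls 2 T)
    (All.map (ℕₚ.<-trans (ℕₚ.n<1+n 1) ∘ proj₁) (refls-bounds 2 T))))))
  (cong₂ _∷_ (trans (ℤₚ.+-comm 1ℤ (+ suc m)) (cong (ℤ._-_ (+ suc m)) (sym (cong (ℤ._+_ (- 1ℤ)) (alphaCoord-below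
    (refls 2 T) (All.map proj₁ (refls-bounds 2 T)))))))
  (trans (act-tilingPerm T) (wt-cong (suc m) λ t _ → cong (ℤ._-_ (tailCoord m t))
    (sym (trans (ℤₚ.+-identityˡ _) (trans (cong (λ J → alphaCoord J (suc (suc t))) (refls-+ 2 0 T))
      (alphaCoord-map-+ 2 (refls 0 T) t))))))))

-- Linear functionals and the partition function

dot : ∀ {m} → (ℕ → ℤ) → Vec ℤ m → ℤ
dot c [] = 0ℤ
dot c (x ∷ v) = c 0 ℤ.* x ℤ.+ dot (c ∘ suc) v

dot-⊖scale : ∀ {m} c k (u v : Vec ℤ m) →
  dot c (zipWith ℤ._-_ u (V.map (λ z → + k ℤ.* z) v)) ≡ dot c u ℤ.- + k ℤ.* dot c v
dot-⊖scale c k [] [] = sym (trans (ℤₚ.+-identityˡ _) (cong -_ (ℤₚ.*-zeroʳ (+ k))))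
dot-⊖scale c k (x ∷ u) (y ∷ v) rewrite dot-⊖scale (c ∘ suc) k u v = alg (c 0) x (+ k) y _ _
  where
  alg : ∀ c x k y a b → c ℤ.* (x ℤ.- k ℤ.* y) ℤ.+ (a ℤ.- k ℤ.* b) ≡ c ℤ.* x ℤ.+ a ℤ.- k ℤ.* (c ℤ.* y ℤ.+ b)
  alg = ℤ-Solver.solve-∀

dot-⊕ : ∀ {m} c (u v : Vec ℤ m) → dot c (zipWith ℤ._+_ u v) ≡ dot c u ℤ.+ dot c v
dot-⊕ c [] [] = refl
dot-⊕ c (x ∷ u) (y ∷ v) rewrite dot-⊕ (c ∘ suc) u v = alg (c 0) x y _ _
  where
  alg : ∀ c x y a b → c ℤ.* (x ℤ.+ y) ℤ.+ (a ℤ.+ b) ≡ (c ℤ.* x ℤ.+ a) ℤ.+ (c ℤ.* y ℤ.+ b)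
  alg = ℤ-Solver.solve-∀

allZero : ∀ {m} → Vec ℤ m → Bool
allZero v = foldr (λ z b → does (z ℤ.≟ 0ℤ) ∧ b) true (toList v)

dot-allZero : ∀ {m} c (v : Vec ℤ m) → allZero v ≡ true → dot c v ≡ 0ℤ
dot-allZero c [] h = refl
dot-allZero c (x ∷ v) h with x ℤ.≟ 0ℤ
... | yes refl = cong₂ ℤ._+_ (ℤₚ.*-zeroʳ (c 0)) (dot-allZero (c ∘ suc) v h)

dot-0 : ∀ {m} (v : Vec ℤ m) → dot (λ _ → 0ℤ) v ≡ 0ℤ
dot-0 [] = refl
dot-0 (x ∷ v) rewrite dot-0 v = refl

δ : ℕ → ℕ → ℤ
δ a t = if t ≡ᵇ a then 1ℤ else 0ℤ

dot-δ : ∀ {m} a f → a < m → dot (δ a) (wt m f) ≡ f a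
dot-δ {suc m} zero f h = trans (cong₂ ℤ._+_ (ℤₚ.*-identityˡ (f 0)) (dot-0 (wt m (f ∘ suc)))) (ℤₚ.+-identityʳ
  (f 0))
dot-δ {suc m} (suc a) f (s≤s h) = trans (ℤₚ.+-identityˡ _) (dot-δ a (f ∘ suc) h)

dot-neg : ∀ {m} c (v : Vec ℤ m) → dot (-_ ∘ c) v ≡ - dot c v
dot-neg c [] = refl
dot-neg c (x ∷ v) rewrite dot-neg (c ∘ suc) v = alg (c 0) x _
  where
  alg : ∀ c x a → (- c) ℤ.* x ℤ.+ - a ≡ - (c ℤ.* x ℤ.+ a)
  alg = ℤ-Solver.solve-∀

dot-negδ : ∀ {m} c b → b < m → dot c (wt m (λ t → if t ≡ᵇ b then - 1ℤ else 0ℤ)) ≡ - c b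
dot-negδ {suc m} c zero h = trans (cong₂ ℤ._+_ (alg (c 0)) (dot-wt0 m (c ∘ suc))) (ℤₚ.+-identityʳ _)
  where
  alg : ∀ x → x ℤ.* -1ℤ ≡ - x
  alg = ℤ-Solver.solve-∀
  dot-wt0 : ∀ m c → dot c (wt m (λ _ → 0ℤ)) ≡ 0ℤ
  dot-wt0 zero c = refl
  dot-wt0 (suc m) c = cong₂ ℤ._+_ (ℤₚ.*-zeroʳ (c 0)) (dot-wt0 m (c ∘ suc))
dot-negδ {suc m} c (suc b) (s≤s h) = trans (cong₂ ℤ._+_ (ℤₚ.*-zeroʳ (c 0)) (dot-negδ (c ∘ suc) b h))
  (ℤₚ.+-identityˡ _)

rootCoord : ℕ → ℕ → ℕ → ℤ
rootCoord a b t = if t ≡ᵇ a then 1ℤ else (if t ≡ᵇ b then - 1ℤ else 0ℤ)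

dot-rootCoord : ∀ {m} c a b → a < b → b < m → dot c (wt m (rootCoord a b)) ≡ c a ℤ.- c b
dot-rootCoord {suc m} c zero (suc b) h (s≤s h') = cong₂ ℤ._+_ (ℤₚ.*-identityʳ (c 0)) (dot-negδ (c ∘ suc) b h')
dot-rootCoord {suc m} c (suc a) (suc b) (s≤s h) (s≤s h') =
  trans (cong₂ ℤ._+_ (ℤₚ.*-zeroʳ (c 0)) (dot-rootCoord (c ∘ suc) a b h h')) (ℤₚ.+-identityˡ _)

-- Index pairs of the positive roots in the order of `posRoots`, so that roots can be discarded and
-- reindexed without inspecting vectors.
pairs : ℕ → List (ℕ × ℕ)
pairs m = concatMap (λ a → concatMap (λ b → if a <ᵇ b then [ (a , b) ] else []) (upTo m)) (upTo m)

root : ∀ m → ℕ × ℕ → Vec ℤ m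
root m (a , b) = wt m (rootCoord a b)

tabulate-toℕ : ∀ n (f : ℕ → A) → L.tabulate {n = n} (f ∘ toℕ) ≡ L.applyUpTo f n
tabulate-toℕ zero f = refl
tabulate-toℕ (suc n) f = cong (f 0 ∷_) (tabulate-toℕ n (f ∘ suc))

concatMap-toℕ : ∀ n (f : ℕ → List A) → concatMap (f ∘ toℕ) (L.allFin n) ≡ concatMap f (upTo n)
concatMap-toℕ n f = trans (sym (Lₚ.concatMap-map f toℕ (L.allFin n)))
  (cong (concatMap f) (trans (Lₚ.map-tabulate id toℕ) (tabulate-toℕ n id)))

posRoots-pairs : ∀ n → posRoots n ≡ L.map (root (suc n)) (pairs (suc n))
posRoots-pairs n = sym (begin
  L.map R (concatMap (λ a → concatMap (cell a) (upTo (suc n))) (upTo (suc n)))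
    ≡⟨ Lₚ.map-concatMap R (λ a → concatMap (cell a) (upTo (suc n))) (upTo (suc n)) ⟩
  concatMap (λ a → L.map R (concatMap (cell a) (upTo (suc n)))) (upTo (suc n))
    ≡⟨ Lₚ.concatMap-cong (λ a → trans (Lₚ.map-concatMap R (cell a) (upTo (suc n)))
         (sym (concatMap-toℕ (suc n) (L.map R ∘ cell a)))) (upTo (suc n)) ⟩
  concatMap (λ a → concatMap (λ b → L.map R (cell a (toℕ b))) (L.allFin (suc n))) (upTo (suc n))
    ≡⟨ concatMap-toℕ (suc n) (λ a → concatMap (λ b → L.map R (cell a (toℕ b))) (L.allFin (suc n))) ⟨
  concatMap (λ a → concatMap (λ b → L.map R (cell (toℕ a) (toℕ b))) (L.allFin (suc n))) (L.allFin (suc n))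
    ≡⟨ Lₚ.concatMap-cong (λ a → Lₚ.concatMap-cong (λ b → map-if (toℕ a) (toℕ b)) (L.allFin (suc n)))
      (L.allFin (suc n)) ⟩
  posRoots n ∎)
  where
  open ≡-Reasoning
  R : ℕ × ℕ → Wt n
  R = root (suc n)
  cell : ℕ → ℕ → List (ℕ × ℕ)
  cell a b = if a <ᵇ b then [ (a , b) ] else []
  map-if : ∀ a b → L.map R (cell a b) ≡ (if a <ᵇ b then [ R (a , b) ] else [])
  map-if a b with a <ᵇ b
  ... | true = refl
  ... | false = refl

pairs-bounds : ∀ m → All (λ (a , b) → a < b × b < m) (pairs m)
pairs-bounds m = Allₚ.concat⁺ (Allₚ.map⁺ (Allₚ.applyUpTo⁺₂ id m λ a →
  Allₚ.concat⁺ (Allₚ.map⁺ (Allₚ.applyUpTo⁺₁ id m λ {b} h → row-bounds a b h))))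
  where
  row-bounds : ∀ a b → b < m → All (λ (a , b) → a < b × b < m) (if a <ᵇ b then [ (a , b) ] else [])
  row-bounds a b h with a <ᵇ b in e
  ... | true = (ℕₚ.<ᵇ⇒< a b (subst T (sym e) tt) , h) ∷ []
  ... | false = []

pairs-∈ : ∀ m i → suc i < m → (i , suc i) ∈ pairs m
pairs-∈ m i h = ∈ₚ.∈-concatMap⁺ _ (Any.map (λ { refl →
    ∈ₚ.∈-concatMap⁺ _ (Any.map (λ { refl → cell }) (∈ₚ.∈-upTo⁺ h)) })
    (∈ₚ.∈-upTo⁺ (ℕₚ.<-trans (ℕₚ.n<1+n i) h)))
  where
  cell : (i , suc i) ∈ (if i <ᵇ suc i then [ (i , suc i) ] else [])
  cell with i <ᵇ suc i | ℕₚ.<⇒<ᵇ (ℕₚ.n<1+n i)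
  ... | true | _ = here refl

sumℕ≢0⁻ : ∀ (f : A → ℕ) xs → sumℕ (L.map f xs) ≢ 0 → ∃ λ x → x ∈ xs × f x ≢ 0
sumℕ≢0⁻ f [] h = contradiction refl h
sumℕ≢0⁻ f (x ∷ xs) h with f x ℕ.≟ 0
... | no ne = x , here refl , ne
... | yes e rewrite e with sumℕ≢0⁻ f xs h
...   | y , m , ne = y , there m , ne

sumℕ≢0⁺ : ∀ (f : A → ℕ) {x xs} → x ∈ xs → f x ≢ 0 → sumℕ (L.map f xs) ≢ 0
sumℕ≢0⁺ f {x} (here refl) ne e = ne (ℕₚ.m+n≡0⇒m≡0 (f x) e)
sumℕ≢0⁺ f {xs = y ∷ _} (there m) ne e = sumℕ≢0⁺ f m ne (ℕₚ.m+n≡0⇒n≡0 (f y) e)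

sumℕ-zero : ∀ (f : A → ℕ) xs → (∀ x → x ∈ xs → f x ≡ 0) → sumℕ (L.map f xs) ≡ 0
sumℕ-zero f [] h = refl
sumℕ-zero f (x ∷ xs) h = cong₂ _+_ (h x (here refl)) (sumℕ-zero f xs (λ y m → h y (there m)))

-- Each of the `k` roots in a decomposition contributes at least `e` to the functional. The case e =
-- 0 is the vanishing criterion, the case e = 1 bounds the number of roots.
countDecomp-bound : ∀ {n} c e (βs : List (Wt n)) → All (λ β → e ℤ.≤ dot c β) βs →
  ∀ ξ k → countDecomp βs ξ k ≢ 0 → + k ℤ.* e ℤ.≤ dot c ξ
countDecomp-bound c e [] [] ξ zero ne with allZero ξ in z
... | true = ℤₚ.≤-reflexive (sym (dot-allZero c ξ z))
... | false = contradiction refl ne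
countDecomp-bound c e [] [] ξ (suc k) ne with allZero ξ
... | true = contradiction refl ne
... | false = contradiction refl ne
countDecomp-bound c e (β ∷ βs) (h ∷ hs) ξ k ne
  with sumℕ≢0⁻ (λ m → countDecomp βs (ξ ⊖ scale m β) (k ∸ m)) (upTo (suc k)) ne
... | m , m∈ , ne' = ℤₚ.≤-trans (ℤₚ.≤-reflexive split)
  (ℤₚ.≤-trans (ℤₚ.+-mono-≤ ih (ℤₚ.*-monoˡ-≤-nonNeg (+ m) h)) (ℤₚ.≤-reflexive (alg (dot c ξ) _)))
  where
  ih : + (k ∸ m) ℤ.* e ℤ.≤ dot c ξ ℤ.- + m ℤ.* dot c β
  ih = subst (+ (k ∸ m) ℤ.* e ℤ.≤_) (dot-⊖scale c m ξ β) (countDecomp-bound c e βs hs _ (k ∸ m) ne')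
  split : + k ℤ.* e ≡ + (k ∸ m) ℤ.* e ℤ.+ + m ℤ.* e
  split = trans (cong (λ j → + j ℤ.* e) (sym (ℕₚ.m∸n+n≡m (ℕₚ.≤-pred (∈ₚ.∈-upTo⁻ m∈))))) (ℤₚ.*-distribʳ-+ e
    (+ (k ∸ m)) (+ m))
  alg : ∀ x y → x ℤ.- y ℤ.+ y ≡ x
  alg = ℤ-Solver.solve-∀

countDecomp-neg : ∀ {n} c (βs : List (Wt n)) → All (λ β → 0ℤ ℤ.≤ dot c β) βs →
  ∀ ξ k → dot c ξ ℤ.< 0ℤ → countDecomp βs ξ k ≡ 0
countDecomp-neg c βs hs ξ k neg with countDecomp βs ξ k ℕ.≟ 0
... | yes e = e
... | no ne = contradiction (subst (ℤ._≤ dot c ξ) (ℤₚ.*-zeroʳ (+ k)) (countDecomp-bound c 0ℤ βs hs ξ k ne))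
  (ℤₚ.<⇒≱ neg)

⊖scale-0 : ∀ {m} (u v : Vec ℤ m) → zipWith ℤ._-_ u (V.map (λ z → 0ℤ ℤ.* z) v) ≡ u
⊖scale-0 [] [] = refl
⊖scale-0 (x ∷ u) (y ∷ v) = cong₂ _∷_ (ℤₚ.+-identityʳ x) (⊖scale-0 u v)

-- A functional that is nonnegative on all roots and vanishes on ξ excludes the roots on which it
-- is positive from every decomposition of ξ.
countDecomp-skip : ∀ {n} c (βs : List (Wt n)) → All (λ β → 0ℤ ℤ.≤ dot c β) βs →
  ∀ β ξ k → 0ℤ ℤ.< dot c β → dot c ξ ≡ 0ℤ → countDecomp (β ∷ βs) ξ k ≡ countDecomp βs ξ k
countDecomp-skip c βs hs β ξ k pos e0 = trans
  (cong₂ _+_ (cong (λ v → countDecomp βs v k) (⊖scale-0 ξ β))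
    (trans (cong (sumℕ ∘ L.map term) (sym (Lₚ.map-upTo suc k)))
      (trans (cong sumℕ (sym (Lₚ.map-∘ (upTo k)))) (sumℕ-zero (term ∘ suc) (upTo k) (λ j _ → vanish j)))))
  (ℕₚ.+-identityʳ _)
  where
  term : ℕ → ℕ
  term m = countDecomp βs (ξ ⊖ scale m β) (k ∸ m)
  vanish : ∀ j → term (suc j) ≡ 0
  vanish j = countDecomp-neg c βs hs _ (k ∸ suc j) (subst (ℤ._< 0ℤ)
    (sym (trans (dot-⊖scale c (suc j) ξ β) (trans (cong (ℤ._- (+ suc j ℤ.* dot c β)) e0) (ℤₚ.+-identityˡ _))))
    (ℤₚ.neg-mono-< (subst (ℤ._< + suc j ℤ.* dot c β) (ℤₚ.*-zeroʳ (+ suc j)) (ℤₚ.*-monoˡ-<-pos (+ suc j) pos))))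

-- Kept roots have functional 0, so `ξ` stays in the kernel while they are subtracted, and each
-- discarded root can be skipped in turn.
countDecomp-filterᵇ : ∀ {n} c (w : A → Wt n) (keep : A → Bool) (ps : List A) →
  All (λ x → (keep x ≡ true × dot c (w x) ≡ 0ℤ) ⊎ (keep x ≡ false × 0ℤ ℤ.< dot c (w x))) ps →
  ∀ ξ k → dot c ξ ≡ 0ℤ →
  countDecomp (L.map w ps) ξ k ≡ countDecomp (L.map w (filterᵇ keep ps)) ξ k
countDecomp-filterᵇ c w keep [] hs ξ k e = refl
countDecomp-filterᵇ c w keep (x ∷ ps) (inj₁ (t , z) ∷ hs) ξ k e0 rewrite t =
  cong sumℕ (Lₚ.map-cong (λ m → countDecomp-filterᵇ c w keep ps hs _ (k ∸ m)
    (trans (dot-⊖scale c m ξ (w x)) (trans (cong₂ (λ a b → a ℤ.- + m ℤ.* b) e0 z) (cong (λ y → 0ℤ ℤ.- y)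
      (ℤₚ.*-zeroʳ (+ m)))))) (upTo (suc k)))
countDecomp-filterᵇ c w keep (x ∷ ps) (inj₂ (f , p) ∷ hs) ξ k e0 rewrite f =
  trans (countDecomp-skip c (L.map w ps) (Allₚ.map⁺ (All.map nonneg hs)) (w x) ξ k p e0)
    (countDecomp-filterᵇ c w keep ps hs ξ k e0)
  where
  nonneg : ∀ {y} → (keep y ≡ true × dot c (w y) ≡ 0ℤ) ⊎ (keep y ≡ false × 0ℤ ℤ.< dot c (w y)) → 0ℤ ℤ.≤ dot c
    (w y)
  nonneg (inj₁ (_ , z)) = ℤₚ.≤-reflexive (sym z)
  nonneg (inj₂ (_ , p)) = ℤₚ.<⇒≤ p

-- Meant for the embeddings of rank n into rank n + 1 that add a zero coordinate at one end.
countDecomp-map : ∀ {n n'} (e : Wt n → Wt n') →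
  (∀ u v k → e (u ⊖ scale k v) ≡ e u ⊖ scale k (e v)) → (∀ u → allZero (e u) ≡ allZero u) →
  ∀ βs ξ k → countDecomp (L.map e βs) (e ξ) k ≡ countDecomp βs ξ k
countDecomp-map e lin z [] ξ k rewrite z ξ = refl
countDecomp-map e lin z (β ∷ βs) ξ k = cong sumℕ (Lₚ.map-cong (λ m →
  trans (cong (λ v → countDecomp (L.map e βs) v (k ∸ m)) (sym (lin ξ β m))) (countDecomp-map e lin z βs _
    (k ∸ m))) (upTo (suc k)))

-- Dropping zero coordinates at either end

filterᵇ-concatMap : (p : B → Bool) (f : A → List B) (xs : List A) →
  filterᵇ p (concatMap f xs) ≡ concatMap (filterᵇ p ∘ f) xs
filterᵇ-concatMap p f [] = refl
filterᵇ-concatMap p f (x ∷ xs) = trans (Lₚ.filter-++ _ (f x) (concatMap f xs)) (cong (filterᵇ p (f x) ++_)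
  (filterᵇ-concatMap p f xs))

concatMap-cong-All : {f g : A → List B} (xs : List A) → All (λ x → f x ≡ g x) xs → concatMap f xs ≡ concatMap g
  xs
concatMap-cong-All [] [] = refl
concatMap-cong-All (x ∷ xs) (h ∷ hs) = cong₂ _++_ h (concatMap-cong-All xs hs)

concatMap-[] : (xs : List A) → concatMap {B = B} (λ _ → []) xs ≡ []
concatMap-[] [] = refl
concatMap-[] (x ∷ xs) = concatMap-[] xs

cell : ℕ → ℕ → List (ℕ × ℕ)
cell a b = if a <ᵇ b then [ (a , b) ] else []

cell-≥ : ∀ a b → b ≤ a → cell a b ≡ []
cell-≥ a b h with a <ᵇ b in e
... | false = refl
... | true = contradiction h (ℕₚ.<⇒≱ (ℕₚ.<ᵇ⇒< a b (subst T (sym e) tt)))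

pairs-init : ∀ m → filterᵇ (λ (a , b) → not (b ≡ᵇ m)) (pairs (suc m)) ≡ pairs m
pairs-init m = begin
  filterᵇ keep (concatMap (λ a → concatMap (cell a) (upTo (suc m))) (upTo (suc m)))
    ≡⟨ filterᵇ-concatMap keep (λ a → concatMap (cell a) (upTo (suc m))) (upTo (suc m)) ⟩
  concatMap (λ a → filterᵇ keep (concatMap (cell a) (upTo (suc m)))) (upTo (suc m))
    ≡⟨ Lₚ.concatMap-cong (λ a → trans (filterᵇ-concatMap keep (cell a) (upTo (suc m))) (row a)) (upTo (suc m)) ⟩
  concatMap (λ a → concatMap (cell a) (upTo m)) (upTo (suc m))
    ≡⟨ cong (concatMap (λ a → concatMap (cell a) (upTo m))) (Lₚ.upTo-∷ʳ m) ⟨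
  concatMap (λ a → concatMap (cell a) (upTo m)) (upTo m ++ [ m ])
    ≡⟨ Lₚ.concatMap-++ (λ a → concatMap (cell a) (upTo m)) (upTo m) [ m ] ⟩
  pairs m ++ (concatMap (cell m) (upTo m) ++ [])
    ≡⟨ cong (λ xs → pairs m ++ (xs ++ [])) (trans (concatMap-cong-All (upTo m) (Allₚ.applyUpTo⁺₁ id m
      (λ {b} h → cell-≥ m b (ℕₚ.<⇒≤ h)))) (concatMap-[] (upTo m))) ⟩
  pairs m ++ []
    ≡⟨ Lₚ.++-identityʳ (pairs m) ⟩
  pairs m ∎
  where
  open ≡-Reasoning
  keep : ℕ × ℕ → Bool
  keep (a , b) = not (b ≡ᵇ m)
  last-cell : ∀ a → filterᵇ keep (cell a m) ≡ []
  last-cell a with a <ᵇ m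
  ... | false = refl
  ... | true rewrite ≡ᵇ-refl m = refl
  kept-cell : ∀ a b → b < m → filterᵇ keep (cell a b) ≡ cell a b
  kept-cell a b h with a <ᵇ b
  ... | false = refl
  ... | true rewrite ≢⇒≡ᵇ-false b m (ℕₚ.<⇒≢ h) = refl
  row : ∀ a → concatMap (filterᵇ keep ∘ cell a) (upTo (suc m)) ≡ concatMap (cell a) (upTo m)
  row a = begin
    concatMap (filterᵇ keep ∘ cell a) (upTo (suc m))
      ≡⟨ cong (concatMap (filterᵇ keep ∘ cell a)) (Lₚ.upTo-∷ʳ m) ⟨
    concatMap (filterᵇ keep ∘ cell a) (upTo m ++ [ m ])
      ≡⟨ Lₚ.concatMap-++ (filterᵇ keep ∘ cell a) (upTo m) [ m ] ⟩
    concatMap (filterᵇ keep ∘ cell a) (upTo m) ++ (filterᵇ keep (cell a m) ++ [])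
      ≡⟨ cong₂ _++_ (concatMap-cong-All (upTo m) (Allₚ.applyUpTo⁺₁ id m (λ {b} h → kept-cell a b h)))
        (trans (Lₚ.++-identityʳ _) (last-cell a)) ⟩
    concatMap (cell a) (upTo m) ++ []
      ≡⟨ Lₚ.++-identityʳ _ ⟩
    concatMap (cell a) (upTo m) ∎

suc×suc : ℕ × ℕ → ℕ × ℕ
suc×suc (a , b) = suc a , suc b

pairs-tail : ∀ m → filterᵇ (λ (a , b) → not (a ≡ᵇ 0)) (pairs (suc m)) ≡ L.map suc×suc (pairs m)
pairs-tail m = begin
  filterᵇ keep (concatMap (λ a → concatMap (cell a) (upTo (suc m))) (upTo (suc m)))
    ≡⟨ filterᵇ-concatMap keep (λ a → concatMap (cell a) (upTo (suc m))) (upTo (suc m)) ⟩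
  concatMap (λ a → filterᵇ keep (concatMap (cell a) (upTo (suc m)))) (upTo (suc m))
    ≡⟨ Lₚ.concatMap-cong (λ a → filterᵇ-concatMap keep (cell a) (upTo (suc m))) (upTo (suc m)) ⟩
  concatMap (λ a → concatMap (filterᵇ keep ∘ cell a) (upTo (suc m))) (upTo (suc m))
    ≡⟨ cong₂ _++_ (trans (Lₚ.concatMap-cong zero-cell (upTo (suc m))) (concatMap-[] (upTo (suc m)))) refl ⟩
  concatMap (λ a → concatMap (filterᵇ keep ∘ cell a) (upTo (suc m))) (L.applyUpTo suc m)
    ≡⟨ cong (concatMap (λ a → concatMap (filterᵇ keep ∘ cell a) (upTo (suc m)))) (sym (Lₚ.map-upTo suc m)) ⟩
  concatMap (λ a → concatMap (filterᵇ keep ∘ cell a) (upTo (suc m))) (L.map suc (upTo m))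
    ≡⟨ Lₚ.concatMap-map _ suc (upTo m) ⟩
  concatMap (λ a → concatMap (filterᵇ keep ∘ cell (suc a)) (upTo (suc m))) (upTo m)
    ≡⟨ Lₚ.concatMap-cong (λ a → trans (cong (concatMap (filterᵇ keep ∘ cell (suc a))) (sym (Lₚ.map-upTo suc m)))
        (trans (Lₚ.concatMap-map _ suc (upTo m)) (Lₚ.concatMap-cong (suc-cell a) (upTo m)))) (upTo m) ⟩
  concatMap (λ a → concatMap (L.map suc×suc ∘ cell a) (upTo m)) (upTo m)
    ≡⟨ Lₚ.concatMap-cong (λ a → sym (Lₚ.map-concatMap suc×suc (cell a) (upTo m))) (upTo m) ⟩
  concatMap (λ a → L.map suc×suc (concatMap (cell a) (upTo m))) (upTo m)
    ≡⟨ Lₚ.map-concatMap suc×suc (λ a → concatMap (cell a) (upTo m)) (upTo m) ⟨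
  L.map suc×suc (pairs m) ∎
  where
  open ≡-Reasoning
  keep : ℕ × ℕ → Bool
  keep (a , b) = not (a ≡ᵇ 0)
  zero-cell : ∀ b → filterᵇ keep (cell 0 b) ≡ []
  zero-cell zero = refl
  zero-cell (suc b) = refl
  suc-cell : ∀ a b → filterᵇ keep (cell (suc a) (suc b)) ≡ L.map suc×suc (cell a b)
  suc-cell a b with a <ᵇ b
  ... | true = refl
  ... | false = refl

wt-∷ʳ : ∀ m f → wt (suc m) f ≡ wt m f V.∷ʳ f m
wt-∷ʳ zero f = refl
wt-∷ʳ (suc m) f = cong (f 0 ∷_) (wt-∷ʳ m (f ∘ suc))

⊖scale-∷ʳ : ∀ {m} k (u v : Vec ℤ m) → zipWith ℤ._-_ u (V.map (λ z → + k ℤ.* z) v) V.∷ʳ 0ℤ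
  ≡ zipWith ℤ._-_ (u V.∷ʳ 0ℤ) (V.map (λ z → + k ℤ.* z) (v V.∷ʳ 0ℤ))
⊖scale-∷ʳ k [] [] rewrite ℤₚ.*-zeroʳ (+ k) = refl
⊖scale-∷ʳ k (x ∷ u) (y ∷ v) = cong (_ ∷_) (⊖scale-∷ʳ k u v)

allZero-∷ʳ : ∀ {m} (u : Vec ℤ m) → allZero (u V.∷ʳ 0ℤ) ≡ allZero u
allZero-∷ʳ [] = refl
allZero-∷ʳ (x ∷ u) = cong (does (x ℤ.≟ 0ℤ) ∧_) (allZero-∷ʳ u)

posRoots-All : ∀ n {P : Wt n → Set} → (∀ a b → a < b → b < suc n → P (root (suc n) (a , b))) → All P
  (posRoots n)
posRoots-All n {P} h = subst (All P) (sym (posRoots-pairs n))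
  (Allₚ.map⁺ (All.map (λ { {a , b} (l , l') → h a b l l' }) (pairs-bounds (suc n))))

δ-nonneg : ∀ a t → 0ℤ ℤ.≤ δ a t
δ-nonneg a t with t ≡ᵇ a
... | true = +≤+ z≤n
... | false = +≤+ z≤n

δ-≢ : ∀ a t → t ≢ a → δ a t ≡ 0ℤ
δ-≢ a t ne rewrite ≢⇒≡ᵇ-false t a ne = refl

-- Minus the last coordinate is nonnegative on positive roots and positive exactly on those that end
-- at the last coordinate. It vanishes on the weight, so these roots drop out and the others come
-- from rank n.
qKostant-init : ∀ n f k → f (suc n) ≡ 0ℤ → qKostant (suc n) (wt (suc (suc n)) f) k ≡ qKostant n (wt (suc n) f) k
qKostant-init n f k e = begin
  countDecomp (posRoots (suc n)) ξ k
    ≡⟨ cong (λ βs → countDecomp βs ξ k) (posRoots-pairs (suc n)) ⟩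
  countDecomp (L.map (root (suc (suc n))) (pairs (suc (suc n)))) ξ k
    ≡⟨ countDecomp-filterᵇ c (root (suc (suc n))) keep (pairs (suc (suc n))) (All.map classify
      (pairs-bounds (suc (suc n)))) ξ k
         (trans (dot-neg (δ (suc n)) ξ) (cong -_ (trans (dot-δ (suc n) f (ℕₚ.n<1+n _)) e))) ⟩
  countDecomp (L.map (root (suc (suc n))) (filterᵇ keep (pairs (suc (suc n))))) ξ k
    ≡⟨ cong (λ ps → countDecomp (L.map (root (suc (suc n))) ps) ξ k) (pairs-init (suc n)) ⟩
  countDecomp (L.map (root (suc (suc n))) (pairs (suc n))) ξ k
    ≡⟨ cong₂ (λ βs v → countDecomp βs v k) (trans (Lₚ.map-cong-local (All.map root-∷ʳ (pairs-bounds (suc n))))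
      (Lₚ.map-∘ (pairs (suc n))))
         (trans (wt-∷ʳ (suc n) f) (cong (wt (suc n) f V.∷ʳ_) e)) ⟩
  countDecomp (L.map (V._∷ʳ 0ℤ) (L.map (root (suc n)) (pairs (suc n)))) (wt (suc n) f V.∷ʳ 0ℤ) k
    ≡⟨ countDecomp-map (V._∷ʳ 0ℤ) (λ u v j → ⊖scale-∷ʳ j u v) allZero-∷ʳ (L.map (root (suc n)) (pairs (suc n)))
      (wt (suc n) f) k ⟩
  countDecomp (L.map (root (suc n)) (pairs (suc n))) (wt (suc n) f) k
    ≡⟨ cong (λ βs → countDecomp βs (wt (suc n) f) k) (posRoots-pairs n) ⟨
  countDecomp (posRoots n) (wt (suc n) f) k ∎
  where
  open ≡-Reasoning
  ξ = wt (suc (suc n)) f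
  c : ℕ → ℤ
  c t = - δ (suc n) t
  keep : ℕ × ℕ → Bool
  keep (a , b) = not (b ≡ᵇ suc n)
  classify : ∀ {x} → proj₁ x < proj₂ x × proj₂ x < suc (suc n) →
    (keep x ≡ true × dot c (root (suc (suc n)) x) ≡ 0ℤ) ⊎ (keep x ≡ false × 0ℤ ℤ.< dot c (root (suc (suc n)) x))
  classify {a , b} (l , l') with dot-rootCoord c a b l l' | b ℕ.≟ suc n
  ... | d | yes refl rewrite ≡ᵇ-refl (suc n) | ≢⇒≡ᵇ-false a (suc n) (ℕₚ.<⇒≢ l) =
    inj₂ (refl , subst (0ℤ ℤ.<_) (sym d) (ℤ.+<+ (s≤s z≤n)))
  ... | d | no ne rewrite ≢⇒≡ᵇ-false b (suc n) ne | ≢⇒≡ᵇ-false a (suc n)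
    (ℕₚ.<⇒≢ (ℕₚ.<-≤-trans l (ℕₚ.≤-pred l'))) = inj₁ (refl , d)
  root-∷ʳ : ∀ {x} → proj₁ x < proj₂ x × proj₂ x < suc n → root (suc (suc n)) x ≡ root (suc n) x V.∷ʳ 0ℤ
  root-∷ʳ {a , b} (l , l') = trans (wt-∷ʳ (suc n) (rootCoord a b)) (cong (root (suc n) (a , b) V.∷ʳ_) z)
    where
    z : rootCoord a b (suc n) ≡ 0ℤ
    z rewrite ≢⇒≡ᵇ-false (suc n) a (ℕₚ.<⇒≢ (ℕₚ.<-trans l l') ∘ sym) | ≢⇒≡ᵇ-false (suc n) b (ℕₚ.<⇒≢ l' ∘ sym) =
      refl

-- The mirror image: the first coordinate is positive exactly on the roots that start there.
qKostant-tail : ∀ n f k → f 0 ≡ 0ℤ → qKostant (suc n) (wt (suc (suc n)) f) k ≡ qKostant n (wt (suc n) (f ∘ suc))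
  k
qKostant-tail n f k e = begin
  countDecomp (posRoots (suc n)) ξ k
    ≡⟨ cong (λ βs → countDecomp βs ξ k) (posRoots-pairs (suc n)) ⟩
  countDecomp (L.map (root (suc (suc n))) (pairs (suc (suc n)))) ξ k
    ≡⟨ countDecomp-filterᵇ (δ 0) (root (suc (suc n))) keep (pairs (suc (suc n))) (All.map classify
      (pairs-bounds (suc (suc n)))) ξ k
         (trans (dot-δ {suc (suc n)} 0 f (s≤s z≤n)) e) ⟩
  countDecomp (L.map (root (suc (suc n))) (filterᵇ keep (pairs (suc (suc n))))) ξ k
    ≡⟨ cong (λ ps → countDecomp (L.map (root (suc (suc n))) ps) ξ k) (pairs-tail (suc n)) ⟩
  countDecomp (L.map (root (suc (suc n))) (L.map suc×suc (pairs (suc n)))) ξ k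
    ≡⟨ cong₂ (λ βs v → countDecomp βs v k) (trans (sym (Lₚ.map-∘ (pairs (suc n)))) (Lₚ.map-∘ (pairs (suc n))))
      (cong (_∷ wt (suc n) (f ∘ suc)) e) ⟩
  countDecomp (L.map (0ℤ ∷_) (L.map (root (suc n)) (pairs (suc n)))) (0ℤ ∷ wt (suc n) (f ∘ suc)) k
    ≡⟨ countDecomp-map (0ℤ ∷_) (λ u v j → cong (_∷ (u ⊖ scale j v))
      (sym (cong (λ x → 0ℤ ℤ.- x) (ℤₚ.*-zeroʳ (+ j))))) (λ _ → refl) (L.map (root (suc n)) (pairs (suc n)))
      (wt (suc n) (f ∘ suc)) k ⟩
  countDecomp (L.map (root (suc n)) (pairs (suc n))) (wt (suc n) (f ∘ suc)) k
    ≡⟨ cong (λ βs → countDecomp βs (wt (suc n) (f ∘ suc)) k) (posRoots-pairs n) ⟨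
  countDecomp (posRoots n) (wt (suc n) (f ∘ suc)) k ∎
  where
  open ≡-Reasoning
  ξ = wt (suc (suc n)) f
  keep : ℕ × ℕ → Bool
  keep (a , b) = not (a ≡ᵇ 0)
  classify : ∀ {x} → proj₁ x < proj₂ x × proj₂ x < suc (suc n) →
    (keep x ≡ true × dot (δ 0) (root (suc (suc n)) x) ≡ 0ℤ) ⊎ (keep x ≡ false × 0ℤ ℤ.< dot (δ 0)
      (root (suc (suc n)) x))
  classify {zero , suc b} (l , l') = inj₂ (refl , subst (0ℤ ℤ.<_) (sym (dot-rootCoord (δ 0) 0 (suc b) l l'))
    (ℤ.+<+ (s≤s z≤n)))
  classify {suc a , suc b} (l , l') = inj₁ (refl , dot-rootCoord (δ 0) (suc a) (suc b) l l')

-- Carries a block of a large rank to a rank of its own, with `p` zero coordinates removed in front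
-- and `q` behind.
qKostant-shift : ∀ p n q f g k → (∀ t → t < p → f t ≡ 0ℤ) → (∀ t → f (p + t) ≡ g t) → (∀ t → n < t → g t ≡ 0ℤ) →
  qKostant (p + (n + q)) (wt (suc (p + (n + q))) f) k ≡ qKostant n (wt (suc n) g) k
qKostant-shift (suc p) n q f g k lo mid hi =
  trans (qKostant-tail (p + (n + q)) f k (lo 0 (s≤s z≤n))) (qKostant-shift p n q (f ∘ suc) g k
    (λ t h → lo (suc t) (s≤s h)) mid hi)
qKostant-shift zero n q f g k lo mid hi =
  trans (cong (λ v → qKostant (n + q) v k) (wt-cong (suc (n + q)) (λ t _ → mid t))) (go q)
  where
  go : ∀ q → qKostant (n + q) (wt (suc (n + q)) g) k ≡ qKostant n (wt (suc n) g) k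
  go zero = cong (λ m → qKostant m (wt (suc m) g) k) (ℕₚ.+-identityʳ n)
  go (suc q) = trans (cong (λ m → qKostant m (wt (suc m) g) k) (ℕₚ.+-suc n q))
    (trans (qKostant-init (n + q) g k (hi (suc (n + q)) (s≤s (ℕₚ.m≤m+n n q)))) (go q))

-- Nonvanishing of the partition function and partial sums

⊕-⊖scale : ∀ {m} k (u w v : Vec ℤ m) →
  zipWith ℤ._-_ (zipWith ℤ._+_ u w) (V.map (λ z → + k ℤ.* z) v) ≡ zipWith ℤ._+_ (zipWith ℤ._-_ u
    (V.map (λ z → + k ℤ.* z) v)) w
⊕-⊖scale k [] [] [] = refl
⊕-⊖scale k (x ∷ u) (y ∷ w) (z ∷ v) = cong₂ _∷_ (alg x y (+ k ℤ.* z)) (⊕-⊖scale k u w v)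
  where
  alg : ∀ x y z → x ℤ.+ y ℤ.- z ≡ x ℤ.- z ℤ.+ y
  alg = ℤ-Solver.solve-∀

⊕-⊖scale-suc : ∀ {m} k (u v : Vec ℤ m) →
  zipWith ℤ._-_ (zipWith ℤ._+_ u v) (V.map (λ z → + suc k ℤ.* z) v) ≡ zipWith ℤ._-_ u (V.map (λ z → + k ℤ.* z)
    v)
⊕-⊖scale-suc k [] [] = refl
⊕-⊖scale-suc k (x ∷ u) (y ∷ v) = cong₂ _∷_ (alg x y (+ k)) (⊕-⊖scale-suc k u v)
  where
  alg : ∀ x y k → x ℤ.+ y ℤ.- (1ℤ ℤ.+ k) ℤ.* y ≡ x ℤ.- k ℤ.* y
  alg = ℤ-Solver.solve-∀

-- The multiplicity of `β` in a given decomposition is raised by one.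
countDecomp-⊕ : ∀ {n} (βs : List (Wt n)) {β} → β ∈ βs → ∀ ξ k → countDecomp βs ξ k ≢ 0 → countDecomp βs (ξ ⊕ β)
  (suc k) ≢ 0
countDecomp-⊕ (γ ∷ βs) (here refl) ξ k ne with sumℕ≢0⁻ (λ m → countDecomp βs (ξ ⊖ scale m γ) (k ∸ m))
  (upTo (suc k)) ne
... | m , m∈ , ne' = sumℕ≢0⁺ (λ m → countDecomp βs ((ξ ⊕ γ) ⊖ scale m γ) (suc k ∸ m)) {suc m}
  (∈ₚ.∈-upTo⁺ (s≤s (∈ₚ.∈-upTo⁻ m∈)))
  (subst (λ v → countDecomp βs v (k ∸ m) ≢ 0) (sym (⊕-⊖scale-suc m ξ γ)) ne')
countDecomp-⊕ (γ ∷ βs) {β} (there β∈) ξ k ne with sumℕ≢0⁻ (λ m → countDecomp βs (ξ ⊖ scale m γ) (k ∸ m))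
  (upTo (suc k)) ne
... | m , m∈ , ne' = sumℕ≢0⁺ (λ m → countDecomp βs ((ξ ⊕ β) ⊖ scale m γ) (suc k ∸ m)) {m}
  (∈ₚ.∈-upTo⁺ (ℕₚ.m<n⇒m<1+n (∈ₚ.∈-upTo⁻ m∈)))
  (subst (λ v → countDecomp βs v (suc k ∸ m) ≢ 0) (sym (⊕-⊖scale m ξ β γ))
    (subst (λ j → countDecomp βs ((ξ ⊖ scale m γ) ⊕ β) j ≢ 0) (sym (ℕₚ.+-∸-assoc 1 (ℕₚ.≤-pred (∈ₚ.∈-upTo⁻ m∈))))
      (countDecomp-⊕ βs β∈ _ (k ∸ m) ne')))

simpleRoot∈posRoots : ∀ n i → 1 ≤ i → i ≤ n → simpleRoot n i ∈ posRoots n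
simpleRoot∈posRoots n (suc i) _ h = subst (simpleRoot n (suc i) ∈_) (sym (posRoots-pairs n))
  (∈ₚ.∈-map⁺ (root (suc n)) (pairs-∈ (suc n) i (s≤s h)))

countDecomp-zeroW : ∀ {n} (βs : List (Wt n)) → countDecomp βs zeroW 0 ≢ 0
countDecomp-zeroW {n} [] = go (suc n)
  where
  go : ∀ m → (if allZero (V.replicate m 0ℤ) ∧ true then 1 else 0) ≢ 0
  go (suc m) = go m
  go zero ()
countDecomp-zeroW (β ∷ βs) e = countDecomp-zeroW βs
  (trans (cong (λ v → countDecomp βs v 0) (sym (⊖scale-0 zeroW β))) (ℕₚ.m+n≡0⇒m≡0 _ e))

⊕-comm : ∀ {n} (u v : Wt n) → u ⊕ v ≡ v ⊕ u
⊕-comm u v = Vₚ.zipWith-comm ℤₚ.+-comm u v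

-- The list itself is a decomposition, with as many parts as it has entries.
qKostant-alphaList : ∀ n is → All (λ i → 1 ≤ i × i ≤ n) is → qKostant n (alphaList n is) (length is) ≢ 0
qKostant-alphaList n [] [] = countDecomp-zeroW (posRoots n)
qKostant-alphaList n (i ∷ is) ((l , l') ∷ hs) = subst (λ v → qKostant n v (suc (length is)) ≢ 0)
  (⊕-comm (alphaList n is) (simpleRoot n i))
  (countDecomp-⊕ (posRoots n) (simpleRoot∈posRoots n i l l') _ _ (qKostant-alphaList n is hs))

∣dot∣-bound : ∀ {m} (c : ℕ → ℤ) (d : ℕ → ℕ) → (∀ t → ∣ c t ∣ ≤ d t) → (v : Vec ℤ m) →
  ∣ dot c v ∣ ≤ sumℕ (L.tabulate (λ j → d (toℕ j) ℕ.* ∣ lookup v j ∣))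
∣dot∣-bound c d h [] = z≤n
∣dot∣-bound c d h (x ∷ v) = ℕₚ.≤-trans (ℤₚ.∣i+j∣≤∣i∣+∣j∣ (c 0 ℤ.* x) (dot (c ∘ suc) v))
  (ℕₚ.+-mono-≤ (subst (ℕ._≤ d 0 ℕ.* ∣ x ∣) (sym (ℤₚ.abs-* (c 0) x)) (ℕₚ.*-monoˡ-≤ ∣ x ∣ (h 0)))
    (∣dot∣-bound (c ∘ suc) (d ∘ suc) (h ∘ suc) v))

-- The functional t ↦ −t has value b − a ≥ 1 on e_a − e_b, so it bounds the number of roots used.
htBound-bounds : ∀ n ξ k → qKostant n ξ k ≢ 0 → k ≤ htBound ξ
htBound-bounds n ξ k ne = ℕₚ.≤-trans (k≤ (dot c ξ) (subst (ℤ._≤ dot c ξ) (ℤₚ.*-identityʳ (+ k))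
  (countDecomp-bound c 1ℤ (posRoots n) (posRoots-All n height) ξ k ne)))
  (subst (∣ dot c ξ ∣ ≤_) (cong sumℕ (sym (Lₚ.map-tabulate id (λ j → toℕ j ℕ.* ∣ lookup ξ j ∣))))
    (∣dot∣-bound c id (λ t → ℕₚ.≤-reflexive (ℤₚ.∣-i∣≡∣i∣ (+ t))) ξ))
  where
  c : ℕ → ℤ
  c t = - (+ t)
  k≤ : ∀ x → + k ℤ.≤ x → k ≤ ∣ x ∣
  k≤ (+ _) (+≤+ h) = h
  alg : ∀ a y → - a ℤ.- - (1ℤ ℤ.+ a ℤ.+ y) ≡ 1ℤ ℤ.+ y
  alg = ℤ-Solver.solve-∀
  height : ∀ a b → a < b → b < suc n → 1ℤ ℤ.≤ dot c (root (suc n) (a , b))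
  height a b l l' with b ∸ suc a | ℕₚ.m+[n∸m]≡n l
  ... | y | refl = ℤₚ.≤-trans (+≤+ (s≤s z≤n)) (ℤₚ.≤-reflexive (sym (trans (dot-rootCoord c a b l l')
    (alg (+ a) (+ y)))))

-- `kostant` sums only up to `htBound`, and a nonzero coefficient cannot lie beyond that bound.
kostant≢0 : ∀ n ξ k → qKostant n ξ k ≢ 0 → kostant n ξ ≢ 0
kostant≢0 n ξ k ne = sumℕ≢0⁺ (qKostant n ξ) {k} (∈ₚ.∈-upTo⁺ (s≤s (htBound-bounds n ξ k ne))) ne

kostant-0 : ∀ n ξ → (∀ k → qKostant n ξ k ≡ 0) → kostant n ξ ≡ 0
kostant-0 n ξ h = sumℕ-zero (qKostant n ξ) (upTo (suc (htBound ξ))) (λ k _ → h k)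

≢0⇒0<ᵇ : ∀ {k} → k ≢ 0 → (0 <ᵇ k) ≡ true
≢0⇒0<ᵇ {zero} h = contradiction refl h
≢0⇒0<ᵇ {suc k} h = refl

-- `dot (step s)` is the sum of the first `s` coordinates: on weights of total 0, the pairing with
-- the s-th fundamental coweight.
step : ℕ → ℕ → ℤ
step s t = if t <ᵇ s then 1ℤ else 0ℤ

step-pos : ∀ n s a b → a < b → b < suc n → 0ℤ ℤ.≤ dot (step s) (root (suc n) (a , b))
step-pos n s a b l l' = subst (0ℤ ℤ.≤_) (sym (dot-rootCoord (step s) a b l l')) (ineq s a b l)
  where
  ineq : ∀ s a b → a < b → 0ℤ ℤ.≤ step s a ℤ.- step s b
  ineq zero a b l = ℤₚ.≤-refl
  ineq (suc s) zero (suc b) l with b <ᵇ s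
  ... | true = ℤₚ.≤-refl
  ... | false = +≤+ z≤n
  ineq (suc s) (suc a) (suc b) (s≤s l) = ineq s a b l

dot⇒PartialSums≥0 : ∀ {m} b (v : Vec ℤ m) → (∀ s → 0ℤ ℤ.≤ b ℤ.+ dot (step s) v) → PartialSums≥0 b v
dot⇒PartialSums≥0 b [] h = tt
dot⇒PartialSums≥0 b (x ∷ v) h =
  subst (0ℤ ℤ.≤_) (cong (ℤ._+_ b) (trans (cong₂ ℤ._+_ (ℤₚ.*-identityˡ x) (dot-0 v)) (ℤₚ.+-identityʳ x))) (h 1) ,
  dot⇒PartialSums≥0 (b ℤ.+ x) v (λ s → subst (0ℤ ℤ.≤_) (trans (cong (λ y → b ℤ.+ (y ℤ.+ dot (step s) v))
    (ℤₚ.*-identityˡ x)) (sym (ℤₚ.+-assoc b x _))) (h (suc s)))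

-- The partial sums of `ξ` are those of ξ - μ, nonnegative because a decomposition exists, plus
-- those of `μ`. Hence one condition on σ serves every `μ` that occurs.
qKostant≢0⇒PartialSums≥0 : ∀ n ξ μ k → (∀ s → 0ℤ ℤ.≤ dot (step s) μ) → qKostant n (ξ ⊖ μ) k ≢ 0 → PartialSums≥0
  0ℤ ξ
qKostant≢0⇒PartialSums≥0 n ξ μ k hμ ne = dot⇒PartialSums≥0 0ℤ ξ λ s → subst (0ℤ ℤ.≤_) (alg s)
  (ℤₚ.+-mono-≤ (subst (ℤ._≤ dot (step s) (ξ ⊖ μ)) (ℤₚ.*-zeroʳ (+ k)) (countDecomp-bound (step s) 0ℤ (posRoots n)
    (posRoots-All n (step-pos n s)) (ξ ⊖ μ) k ne)) (hμ s))
  where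
  restore : ∀ {m} (u v : Vec ℤ m) → zipWith ℤ._+_ (zipWith ℤ._-_ u v) v ≡ u
  restore [] [] = refl
  restore (x ∷ u) (y ∷ v) = cong₂ _∷_ (a x y) (restore u v)
    where
    a : ∀ x y → x ℤ.- y ℤ.+ y ≡ x
    a = ℤ-Solver.solve-∀
  alg : ∀ s → dot (step s) (ξ ⊖ μ) ℤ.+ dot (step s) μ ≡ 0ℤ ℤ.+ dot (step s) ξ
  alg s = trans (sym (dot-⊕ (step s) (ξ ⊖ μ) μ)) (trans (cong (dot (step s)) (restore ξ μ))
    (sym (ℤₚ.+-identityˡ _)))

-- Simple reflections and θ + ρ

interval : ℕ → ℕ → List ℕ
interval a zero = []
interval a (suc l) = a ∷ interval (suc a) l

range-interval : ∀ a b → range a b ≡ interval a (suc b ∸ a)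
range-interval a b = trans (Lₚ.map-upTo (a ℕ.+_) (suc b ∸ a)) (go a (a ℕ.+_) (suc b ∸ a) (λ _ → refl))
  where
  go : ∀ a f n → (∀ t → f t ≡ a + t) → L.applyUpTo f n ≡ interval a n
  go a f zero h = refl
  go a f (suc n) h = cong₂ _∷_ (trans (h 0) (ℕₚ.+-identityʳ a)) (go (suc a) (f ∘ suc) n (λ t → trans (h (suc t))
    (ℕₚ.+-suc a t)))

interval-bounds : ∀ a l → All (λ i → a ≤ i × i < a + l) (interval a l)
interval-bounds a zero = []
interval-bounds a (suc l) = (ℕₚ.≤-refl , subst (a <_) (sym (ℕₚ.+-suc a l)) (s≤s (ℕₚ.m≤m+n a l))) ∷
  All.map (λ { {i} (h , h') → ℕₚ.<⇒≤ h , subst (i <_) (sym (ℕₚ.+-suc a l)) h' }) (interval-bounds (suc a) l)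

interval-++ : ∀ a l l' → interval a (l + l') ≡ interval a l ++ interval (a + l) l'
interval-++ a zero l' = cong (λ b → interval b l') (sym (ℕₚ.+-identityʳ a))
interval-++ a (suc l) l' = cong (a ∷_) (trans (interval-++ (suc a) l l') (cong (λ b → interval (suc a) l ++
  interval b l') (sym (ℕₚ.+-suc a l))))

interval-∷ʳ : ∀ a l → interval a (suc l) ≡ interval a l ++ [ a + l ]
interval-∷ʳ a l = trans (cong (interval a) (ℕₚ.+-comm 1 l)) (interval-++ a l 1)

interval-+ : ∀ p a l → interval (p + a) l ≡ L.map (p ℕ.+_) (interval a l)
interval-+ p a zero = refl
interval-+ p a (suc l) = cong (p + a ∷_) (trans (cong (λ b → interval b l) (sym (ℕₚ.+-suc p a)))
  (interval-+ p (suc a) l))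

simpleCoord-δ : ∀ a t → simpleCoord a t ≡ δ a (suc t) ℤ.- δ (suc a) (suc t)
simpleCoord-δ a t with suc t ℕ.≟ a
... | yes refl rewrite ≡ᵇ-refl t | ≢⇒≡ᵇ-false t (suc t) (ℕₚ.<⇒≢ (ℕₚ.n<1+n t)) = refl
... | no ne rewrite ≢⇒≡ᵇ-false (suc t) a ne with t ≡ᵇ a
...   | true = refl
...   | false = refl

-- The sum telescopes to e_a - e_(a+l), with `suc t` as the 1-based coordinate.
alphaCoord-interval : ∀ a l t → alphaCoord (interval a l) t ≡ δ a (suc t) ℤ.- δ (a + l) (suc t)
alphaCoord-interval a zero t rewrite ℕₚ.+-identityʳ a = sym (ℤₚ.+-inverseʳ (δ a (suc t)))
alphaCoord-interval a (suc l) t rewrite simpleCoord-δ a t | alphaCoord-interval (suc a) l t | ℕₚ.+-suc a l = alg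
  (δ a (suc t)) (δ (suc a) (suc t)) (δ (suc (a + l)) (suc t))
  where
  alg : ∀ x y z → (x ℤ.- y) ℤ.+ (y ℤ.- z) ≡ x ℤ.- z
  alg = ℤ-Solver.solve-∀

-- The weight θ + ρ, and m_q as a sum over tilings

θρCoord : ℕ → ℕ → ℤ
θρCoord n t = alphaCoord (interval 1 n) t ℤ.+ + (n ∸ t)

θ⊕ρ : ∀ n → theta n ⊕ rho n ≡ wt (suc n) (θρCoord n)
θ⊕ρ n = trans (cong (_⊕ rho n) (trans (alphaList-wt n (range 1 n)) (cong (λ is → wt (suc n) (alphaCoord is))
  (range-interval 1 n))))
  (wt-⊕ (suc n) (alphaCoord (interval 1 n)) (λ t → + (n ∸ t)))

θρCoord-inner : ∀ n t → t < n → θρCoord (suc n) (suc t) ≡ + (n ∸ t)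
θρCoord-inner n t h rewrite alphaCoord-interval 1 (suc n) (suc t) | ≢⇒≡ᵇ-false t n (ℕₚ.<⇒≢ h) = refl

θρCoord-tailCoord : ∀ m t → t < suc m → θρCoord (suc m) (suc t) ≡ tailCoord m t
θρCoord-tailCoord m t h = trans (cong (ℤ._+ + (m ∸ t)) (alphaCoord-interval 1 (suc m) (suc t))) (go m t h)
  where
  go : ∀ m t → t < suc m → (0ℤ ℤ.- δ m t) ℤ.+ + (m ∸ t) ≡ tailCoord m t
  go zero zero h = refl
  go (suc m) zero h = refl
  go (suc m) (suc t) (s≤s h) = go m t h
  go zero (suc t) (s≤s ())

θρCoord-zero : ∀ m → θρCoord (suc m) 0 ≡ + suc (suc m)
θρCoord-zero m = cong (ℤ._+ + suc m) (alphaCoord-interval 1 (suc m) 0)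

θ⊕ρ-tailWeight : ∀ m → theta (suc m) ⊕ rho (suc m) ≡ + suc (suc m) ∷ tailWeight m
θ⊕ρ-tailWeight m = trans (θ⊕ρ (suc m)) (cong₂ _∷_ (θρCoord-zero m) (wt-cong (suc m) (θρCoord-tailCoord m)))

dotArg-wt : ∀ n σ f μ → act σ (theta n ⊕ rho n) ≡ wt (suc n) f →
  dotArg n σ (theta n) (wt (suc n) μ) ≡ wt (suc n) (λ t → f t ℤ.- + (n ∸ t) ℤ.- μ t)
dotArg-wt n σ f μ e = trans (cong (λ v → (v ⊖ rho n) ⊖ wt (suc n) μ) e)
  (trans (cong (_⊖ wt (suc n) μ) (wt-⊖ (suc n) f (λ t → + (n ∸ t)))) (wt-⊖ (suc n) (λ t → f t ℤ.- + (n ∸ t)) μ))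

dotArg-alpha : ∀ n σ J μ → act σ (theta n ⊕ rho n) ≡ wt (suc n) (λ t → θρCoord n t ℤ.- alphaCoord J t) →
  dotArg n σ (theta n) (wt (suc n) μ) ≡ wt (suc n) (λ t → alphaCoord (interval 1 n) t ℤ.- μ t ℤ.- alphaCoord J
    t)
dotArg-alpha n σ J μ e = trans (dotArg-wt n σ (λ t → θρCoord n t ℤ.- alphaCoord J t) μ e) (wt-cong (suc n)
  (λ t _ → alg (alphaCoord (interval 1 n) t) (+ (n ∸ t)) (alphaCoord J t) (μ t)))
  where
  alg : ∀ θ ρ α μ → (θ ℤ.+ ρ ℤ.- α) ℤ.- ρ ℤ.- μ ≡ θ ℤ.- μ ℤ.- α
  alg = ℤ-Solver.solve-∀

act-shift-tilingPerm : ∀ {m} (T : Tiling m) →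
  act (shift (tilingPerm T)) (theta (suc m) ⊕ rho (suc m)) ≡ wt (suc (suc m)) (λ t → θρCoord (suc m) t ℤ.-
    alphaCoord (refls 1 T) t)
act-shift-tilingPerm {m} T = trans (cong (act (shift (tilingPerm T))) (θ⊕ρ-tailWeight m))
  (trans (act-shift (tilingPerm T) (+ suc (suc m)) (tailWeight m))
  (cong₂ _∷_ (sym (trans (cong₂ ℤ._-_ (θρCoord-zero m) (alphaCoord-below (refls 1 T) (All.map proj₁
    (refls-bounds 1 T)))) (ℤₚ.+-identityʳ _)))
    (trans (act-tilingPerm T) (wt-cong (suc m) λ t h → cong₂ ℤ._-_ (sym (θρCoord-tailCoord m t h))
      (sym (trans (cong (λ J → alphaCoord J (suc t)) (refls-suc 0 T)) (alphaCoord-map-+ 1 (refls 0 T) t)))))))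

-- At the very start the budget is 0 and the first coordinate of `ρ` is m + 1. All coordinates of
-- `tailWeight m` are at most m, so the largest coordinate of `θ + ρ` has to stay first, and it
-- leaves the budget 1.
∑-allPerms-top : ∀ m (F : Perm (suc (suc m)) → ℤ) →
  (∀ p → ¬ PartialSums≥0 0ℤ (act p (+ suc (suc m) ∷ tailWeight m) ⊖ rho (suc m)) → F p ≡ 0ℤ) →
  ∑ (allPerms (suc (suc m))) F ≡ ∑Tiling m (F ∘ shift ∘ tilingPerm)
∑-allPerms-top m F h = begin
  ∑ (allPerms (suc (suc m))) F
    ≡⟨ ∑-allPerms (suc m) F ⟩
  ∑ (allPerms (suc m)) (λ p → F (shift p) ℤ.+ ∑ (L.tabulate F.suc) (F ∘ insertZero p))
    ≡⟨ ∑-cong (allPerms (suc m)) (λ p → trans (cong (ℤ._+_ (F (shift p))) (moved p)) (ℤₚ.+-identityʳ _)) ⟩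
  ∑ (allPerms (suc m)) (F ∘ shift)
    ≡⟨ ∑-allPerms≡∑Tiling m (F ∘ shift) (λ p nd → h (shift p) (nd ∘ tail-PartialSums≥0 p)) ⟩
  ∑Tiling m (F ∘ shift ∘ tilingPerm) ∎
  where
  open ≡-Reasoning
  moved : ∀ p → ∑ (L.tabulate F.suc) (F ∘ insertZero p) ≡ 0ℤ
  moved p@(x ∷ w) = ∑-tabulate-zero F.suc (F ∘ insertZero p) λ i → h _ λ d → <0⇒≱0 (neg-drop m 0 _
    (lookup-tailWeight≤ m x)) (proj₁ d)
  budget : ∀ x → 0ℤ ℤ.+ (1ℤ ℤ.+ x ℤ.- x) ≡ 1ℤ
  budget = ℤ-Solver.solve-∀
  tail-PartialSums≥0 : ∀ p → PartialSums≥0 0ℤ (act (shift p) (+ suc (suc m) ∷ tailWeight m) ⊖ rho (suc m)) →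
    PartialSums≥0 1ℤ (act p (tailWeight m) ⊖ rho m)
  tail-PartialSums≥0 p d = subst (λ b → PartialSums≥0 b (act p (tailWeight m) ⊖ rho m)) (budget (+ suc m))
    (proj₂ (subst (λ v → PartialSums≥0 0ℤ (v ⊖ rho (suc m))) (act-shift p (+ suc (suc m)) (tailWeight m)) d))

-- A permutation whose coefficient is nonzero passes the partial sum test and is therefore a tiling
-- behind a fixed first entry. The sum runs over all such tilings, including any whose coefficient
-- is 0.
mq-tilings : ∀ m μ k → (∀ s → 0ℤ ℤ.≤ dot (step s) (wt (suc (suc m)) μ)) →
  mq (suc m) (theta (suc m)) (wt (suc (suc m)) μ) k ≡
  ∑Tiling m (λ T → sgn (dominoes T) ℤ.* + qKostant (suc m) (wt (suc (suc m)) (λ t → alphaCoord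
    (interval 1 (suc m)) t ℤ.- μ t ℤ.- alphaCoord (refls 1 T) t)) k)
mq-tilings m μ k hμ = trans (∑-allPerms-top m F supp)
  (∑Tiling-cong m λ T → cong₂ (λ l v → sgn l ℤ.* + qKostant (suc m) v k) (trans (len-shift (tilingPerm T))
    (len-tilingPerm T))
    (dotArg-alpha (suc m) (shift (tilingPerm T)) (refls 1 T) μ (act-shift-tilingPerm T)))
  where
  M = wt (suc (suc m)) μ
  F : Perm (suc (suc m)) → ℤ
  F σ = sgn (len σ) ℤ.* + qKostant (suc m) (dotArg (suc m) σ (theta (suc m)) M) k
  supp : ∀ p → ¬ PartialSums≥0 0ℤ (act p (+ suc (suc m) ∷ tailWeight m) ⊖ rho (suc m)) → F p ≡ 0ℤ
  supp p nd with qKostant (suc m) (dotArg (suc m) p (theta (suc m)) M) k ℕ.≟ 0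
  ... | yes e = trans (cong (λ x → sgn (len p) ℤ.* + x) e) (ℤₚ.*-zeroʳ (sgn (len p)))
  ... | no ne = contradiction (subst (λ v → PartialSums≥0 0ℤ (act p v ⊖ rho (suc m))) (θ⊕ρ-tailWeight m)
    (qKostant≢0⇒PartialSums≥0 (suc m) (act p (theta (suc m) ⊕ rho (suc m)) ⊖ rho (suc m)) M k hμ ne)) nd

-- Products of simple reflections: action and length

transposition : ℕ → ℕ → ℕ
transposition i t = if t ≡ᵇ (i ∸ 1) then i else (if t ≡ᵇ i then i ∸ 1 else t)

-- The first reflection of the list acts last on the weight, so its transposition is the first to be
-- applied to the index.
permuteBy : (ℕ → ℤ) → List ℕ → ℕ → ℤ
permuteBy f [] = f
permuteBy f (i ∷ J) = permuteBy f J ∘ transposition i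

toℕ-natFin : ∀ n i → i ≤ n → toℕ (natFin {n} i) ≡ i
toℕ-natFin n zero h = refl
toℕ-natFin (suc n) (suc i) (s≤s h) = cong suc (toℕ-natFin n i h)

transpositionFin : ∀ {n} → ℕ → Fin (suc n) → Fin (suc n)
transpositionFin i k = if toℕ k ≡ᵇ (i ∸ 1) then natFin i else (if toℕ k ≡ᵇ i then natFin (i ∸ 1) else k)

act-sRefl : ∀ n i f → i ≤ n → act (sRefl n i) (wt (suc n) f) ≡ wt (suc n) (f ∘ transposition i)
act-sRefl n i f h = trans (sym (Vₚ.tabulate-∘ (lookup (wt (suc n) f)) (transpositionFin i)))
  (Vₚ.tabulate-cong λ k → trans (Vₚ.lookup∘tabulate (f ∘ toℕ) (transpositionFin i k)) (cong f (entry k)))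
  where
  entry : ∀ k → toℕ (transpositionFin i k) ≡ transposition i (toℕ k)
  entry k with toℕ k ≡ᵇ (i ∸ 1) | toℕ k ≡ᵇ i
  ... | true | _ = toℕ-natFin n i h
  ... | false | true = toℕ-natFin n (i ∸ 1) (ℕₚ.≤-trans (ℕₚ.m∸n≤m i 1) h)
  ... | false | false = refl

act-⋆ : ∀ {n} (w₁ w₂ : Perm (suc n)) v → act (w₁ ⋆ w₂) v ≡ act w₁ (act w₂ v)
act-⋆ w₁ w₂ v = trans (sym (Vₚ.map-∘ (lookup v) (lookup w₂) w₁))
  (Vₚ.map-cong (λ x → sym (Vₚ.lookup-map x (lookup v) w₂)) w₁)

act-prodRefl : ∀ n f J → All (_≤ n) J → act (prodRefl n J) (wt (suc n) f) ≡ wt (suc n) (permuteBy f J)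
act-prodRefl n f [] [] = Vₚ.map-lookup-allFin (wt (suc n) f)
act-prodRefl n f (i ∷ J) (h ∷ hs) = trans (act-⋆ (sRefl n i) (prodRefl n J) (wt (suc n) f))
  (trans (cong (act (sRefl n i)) (act-prodRefl n f J hs)) (act-sRefl n i (permuteBy f J) h))

noConsec-∷ : ∀ i J → noConsec (i ∷ J) ≡ true → All (suc i <_) J × noConsec J ≡ true
noConsec-∷ i [] h = [] , refl
noConsec-∷ i (j ∷ J) h with suc i <ᵇ j in e
... | true = (i<j ∷ All.map (λ l → ℕₚ.<-trans (ℕₚ.<-trans i<j (ℕₚ.n<1+n j)) l) (proj₁ (noConsec-∷ j J h))) , h
  where i<j = ℕₚ.<ᵇ⇒< (suc i) j (subst T (sym e) tt)

∷-noConsec : ∀ i J → All (suc i <_) J → noConsec (i ∷ J) ≡ noConsec J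
∷-noConsec i [] [] = refl
∷-noConsec i (j ∷ J) (h ∷ _) with suc i <ᵇ j | ℕₚ.<⇒<ᵇ h
... | true | _ = refl

transposition-fix : ∀ i t → t ≢ i ∸ 1 → t ≢ i → transposition i t ≡ t
transposition-fix i t h h' rewrite ≢⇒≡ᵇ-false t (i ∸ 1) h | ≢⇒≡ᵇ-false t i h' = refl

-- Later entries exceed i + 1, so the rest of the list leaves alone the two coordinates that s_i
-- swaps. These differ by 1, and swapping them subtracts α_i.
permuteBy-alphaCoord : ∀ n v → (∀ i → 1 ≤ i → suc i < n → v i ≡ 1ℤ ℤ.+ v (suc i)) →
  ∀ J → noConsec J ≡ true → All (λ i → 1 < i × i < n) J → ∀ t → permuteBy v J t ≡ v t ℤ.- alphaCoord J t
permuteBy-alphaCoord n v hv [] nc [] t = sym (ℤₚ.+-identityʳ (v t))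
permuteBy-alphaCoord n v hv (suc i ∷ J) nc ((s≤s 1≤i , i<n) ∷ hs) t with noConsec-∷ (suc i) J nc
... | far , nc' with permuteBy-alphaCoord n v hv J nc' hs | t ℕ.≟ i | t ℕ.≟ suc i
... | ih | yes refl | _ rewrite ≡ᵇ-refl t = trans (ih (suc t))
  (trans (cong (ℤ._-_ (v (suc t))) (alphaCoord-below J far))
    (sym (trans (cong₂ (λ x y → x ℤ.- (1ℤ ℤ.+ y)) (hv t 1≤i i<n) (alphaCoord-below J
      (All.map (ℕₚ.<-trans (ℕₚ.n<1+n _)) far))) (alg (v (suc t))))))
  where
  alg : ∀ y → 1ℤ ℤ.+ y ℤ.- (1ℤ ℤ.+ 0ℤ) ≡ y ℤ.- 0ℤ
  alg = ℤ-Solver.solve-∀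
... | ih | no ne | yes refl rewrite ≢⇒≡ᵇ-false (suc i) i ne | ≡ᵇ-refl i = trans (ih i)
  (trans (cong₂ ℤ._-_ (hv i 1≤i i<n) (alphaCoord-below J (All.map (ℕₚ.<-trans (ℕₚ.n<1+n _)) far)))
    (sym (trans (cong (λ y → v (suc i) ℤ.- (-1ℤ ℤ.+ y)) (alphaCoord-below J far)) (alg (v (suc i))))))
  where
  alg : ∀ y → y ℤ.- (-1ℤ ℤ.+ 0ℤ) ≡ 1ℤ ℤ.+ y ℤ.- 0ℤ
  alg = ℤ-Solver.solve-∀
... | ih | no ne | no ne' rewrite ≢⇒≡ᵇ-false t i ne | ≢⇒≡ᵇ-false t (suc i) ne' =
  trans (ih t) (cong (ℤ._-_ (v t)) (sym (ℤₚ.+-identityˡ (alphaCoord J t))))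

-- Unit gaps occur only between inner coordinates. At either end the gap is larger, which is why 1
-- and the rank are kept out of the lists of reflections.
θρCoord-step : ∀ n i → 1 ≤ i → suc i < n → θρCoord n i ≡ 1ℤ ℤ.+ θρCoord n (suc i)
θρCoord-step (suc n) (suc i) _ (s≤s h) = begin
  θρCoord (suc n) (suc i) ≡⟨ θρCoord-inner n i (ℕₚ.<-trans (ℕₚ.n<1+n i) h) ⟩
  + (n ∸ i) ≡⟨ cong +_ (ℕₚ.+-∸-assoc 1 (ℕₚ.<⇒≤ h)) ⟩
  + (1 + (n ∸ suc i)) ≡⟨ cong (ℤ._+_ 1ℤ) (θρCoord-inner n (suc i) h) ⟨
  1ℤ ℤ.+ θρCoord (suc n) (suc (suc i)) ∎
  where open ≡-Reasoning

act-prodRefl-θρ : ∀ n J → noConsec J ≡ true → All (λ i → 1 < i × i < n) J →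
  act (prodRefl n J) (theta n ⊕ rho n) ≡ wt (suc n) (λ t → θρCoord n t ℤ.- alphaCoord J t)
act-prodRefl-θρ n J nc hs = trans (cong (act (prodRefl n J)) (θ⊕ρ n))
  (trans (act-prodRefl n (θρCoord n) J (All.map (ℕₚ.<⇒≤ ∘ proj₂) hs))
    (wt-cong (suc n) (λ t _ → permuteBy-alphaCoord n (θρCoord n) (θρCoord-step n) J nc hs t)))

idPerm-shift : ∀ n → idPerm {suc n} ≡ shift idPerm
idPerm-shift n = cong (F.zero ∷_) (Vₚ.tabulate-∘ F.suc id)

shift-⋆ : ∀ {n} (w₁ w₂ : Perm n) → shift w₁ ⋆ shift w₂ ≡ shift (w₁ ⋆ w₂)
shift-⋆ w₁ w₂ = cong (F.zero ∷_) (trans (sym (Vₚ.map-∘ _ F.suc w₁))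
  (trans (Vₚ.map-cong (λ x → Vₚ.lookup-map x F.suc w₂) w₁) (Vₚ.map-∘ F.suc (lookup w₂) w₁)))

sRefl-suc : ∀ n i → sRefl (suc n) (suc (suc i)) ≡ shift (sRefl n (suc i))
sRefl-suc n i = cong (F.zero ∷_) (trans (Vₚ.tabulate-cong entry) (Vₚ.tabulate-∘ F.suc (transpositionFin
  (suc i))))
  where
  entry : ∀ k → transpositionFin (suc (suc i)) (F.suc k) ≡ F.suc (transpositionFin (suc i) k)
  entry k with toℕ k ≡ᵇ i | toℕ k ≡ᵇ suc i
  ... | true | _ = refl
  ... | false | true = refl
  ... | false | false = refl

prodRefl-suc : ∀ n J → All (0 <_) J → prodRefl (suc n) (L.map suc J) ≡ shift (prodRefl n J)
prodRefl-suc n [] [] = idPerm-shift (suc n)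
prodRefl-suc n (suc i ∷ J) (_ ∷ hs) = trans (cong₂ _⋆_ (sRefl-suc n i) (prodRefl-suc n J hs))
  (shift-⋆ (sRefl n (suc i)) (prodRefl n J))

sRefl-1-⋆ : ∀ n (w : Perm (suc n)) → sRefl (suc (suc n)) 1 ⋆ shift (shift w) ≡ swapShift w
sRefl-1-⋆ n w = cong (λ u → F.suc F.zero ∷ F.zero ∷ u) (trans (sym (Vₚ.tabulate-∘ (lookup (shift (shift w)))
  (F.suc ∘ F.suc)))
  (trans (Vₚ.tabulate-cong (λ k → trans (Vₚ.lookup-map k F.suc (V.map F.suc w)) (cong F.suc (Vₚ.lookup-map k
    F.suc w))))
    (trans (Vₚ.tabulate-∘ (F.suc ∘ F.suc) (lookup w)) (trans (Vₚ.map-∘ F.suc F.suc (tabulate (lookup w)))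
      (cong (V.map F.suc ∘ V.map F.suc) (Vₚ.tabulate∘lookup w))))))

len-idPerm : ∀ n → len (idPerm {n}) ≡ 0
len-idPerm zero = refl
len-idPerm (suc n) = trans (cong len (idPerm-shift n)) (trans (len-shift (idPerm {n})) (len-idPerm n))

refls-pos : ∀ {m} s (T : Tiling m) → All (0 <_) (refls s T)
refls-pos s T = All.map (λ { (h , _) → ℕₚ.≤-<-trans z≤n h }) (refls-bounds s T)

-- The product is rebuilt from `shift` and `swapShift`, whose inversions are known; leading fixed
-- points are stripped one at a time.
len-prodRefl : ∀ {m} s (T : Tiling m) n → s + m ≤ n → len (prodRefl n (refls s T)) ≡ dominoes T
len-prodRefl-suc : ∀ {m} s (T : Tiling m) n → s + m ≤ n → len (prodRefl (suc n) (refls (suc s) T)) ≡ dominoes T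
len-prodRefl-suc s T n h = trans (cong (len ∘ prodRefl (suc n)) (refls-suc s T))
  (trans (cong len (prodRefl-suc n (refls s T) (refls-pos s T))) (trans (len-shift (prodRefl n (refls s T)))
    (len-prodRefl s T n h)))
len-prodRefl (suc s) T (suc n) (s≤s h) = len-prodRefl-suc s T n h
len-prodRefl zero nil n h = len-idPerm (suc n)
len-prodRefl zero (mono T) (suc n) (s≤s h) = len-prodRefl-suc zero T n h
len-prodRefl zero (domino T) (suc (suc n)) (s≤s (s≤s h)) = trans (cong len unfold)
  (trans (len-swapShift (prodRefl n (refls 0 T))) (cong suc (len-prodRefl zero T n h)))
  where
  unfold : prodRefl (suc (suc n)) (1 ∷ refls 2 T) ≡ swapShift (prodRefl n (refls 0 T))
  unfold = trans (cong (sRefl (suc (suc n)) 1 ⋆_) (trans (cong (prodRefl (suc (suc n))) (refls-suc 1 T))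
    (trans (prodRefl-suc (suc n) (refls 1 T) (refls-pos 1 T)) (cong shift (trans (cong (prodRefl (suc n))
      (refls-suc 0 T)) (prodRefl-suc n (refls 0 T) (refls-pos 0 T)))))))
    (sRefl-1-⋆ n (prodRefl n (refls 0 T)))

-- The sum over S(J)

∑-sublists-∷ : ∀ x L (h : List ℕ → ℤ) → ∑ (sublists (x ∷ L)) h ≡ ∑ (sublists L) h ℤ.+ ∑ (sublists L)
  (h ∘ (x ∷_))
∑-sublists-∷ x L h = trans (∑-++ h (sublists L) (L.map (x ∷_) (sublists L))) (cong (ℤ._+_ (∑ (sublists L) h))
  (∑-map h (x ∷_) (sublists L)))

-- For the last interval, where the element to be split off, the rank itself, stands at the end.
∑-sublists-∷ʳ : ∀ x L (h : List ℕ → ℤ) → ∑ (sublists (L ++ [ x ])) h ≡ ∑ (sublists L) h ℤ.+ ∑ (sublists L)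
  (h ∘ (_++ [ x ]))
∑-sublists-∷ʳ x [] h = cong (ℤ._+ (h [ x ] ℤ.+ 0ℤ)) (sym (ℤₚ.+-identityʳ (h [])))
∑-sublists-∷ʳ x (y ∷ L) h = begin
  ∑ (sublists (y ∷ L ++ [ x ])) h
    ≡⟨ ∑-sublists-∷ y (L ++ [ x ]) h ⟩
  ∑ (sublists (L ++ [ x ])) h ℤ.+ ∑ (sublists (L ++ [ x ])) (h ∘ (y ∷_))
    ≡⟨ cong₂ ℤ._+_ (∑-sublists-∷ʳ x L h) (∑-sublists-∷ʳ x L (h ∘ (y ∷_))) ⟩
  (∑ (sublists L) h ℤ.+ ∑ (sublists L) (h ∘ (_++ [ x ]))) ℤ.+ (∑ (sublists L) (h ∘ (y ∷_)) ℤ.+ ∑ (sublists L)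
    (h ∘ (_++ [ x ]) ∘ (y ∷_)))
    ≡⟨ +-interchange (∑ (sublists L) h) (∑ (sublists L) (h ∘ (_++ [ x ]))) (∑ (sublists L) (h ∘ (y ∷_)))
      (∑ (sublists L) (h ∘ (_++ [ x ]) ∘ (y ∷_))) ⟩
  (∑ (sublists L) h ℤ.+ ∑ (sublists L) (h ∘ (y ∷_))) ℤ.+ (∑ (sublists L) (h ∘ (_++ [ x ])) ℤ.+ ∑ (sublists L)
    (h ∘ (_++ [ x ]) ∘ (y ∷_)))
    ≡⟨ cong₂ ℤ._+_ (∑-sublists-∷ y L h) (∑-sublists-∷ y L (h ∘ (_++ [ x ]))) ⟨
  ∑ (sublists (y ∷ L)) h ℤ.+ ∑ (sublists (y ∷ L)) (h ∘ (_++ [ x ])) ∎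
  where open ≡-Reasoning

∑-sublists-cong : ∀ L {h h' : List ℕ → ℤ} → (∀ J → J ⊆ L → h J ≡ h' J) → ∑ (sublists L) h ≡ ∑ (sublists L) h'
∑-sublists-cong [] e = cong (ℤ._+ 0ℤ) (e [] [])
∑-sublists-cong (x ∷ L) {h} {h'} e = trans (∑-sublists-∷ x L h)
  (trans (cong₂ ℤ._+_ (∑-sublists-cong L (λ J s → e J (x ∷ʳ s))) (∑-sublists-cong L (λ J s → e (x ∷ J)
    (refl ∷ s))))
    (sym (∑-sublists-∷ x L h')))

∑-sublists-zero : ∀ L {h : List ℕ → ℤ} → (∀ J → J ⊆ L → h J ≡ 0ℤ) → ∑ (sublists L) h ≡ 0ℤ
∑-sublists-zero L e = trans (∑-sublists-cong L e) (∑-zero (sublists L) (λ _ → refl))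

∑-sublists-∷-zero : ∀ x L (h : List ℕ → ℤ) → (∀ J → J ⊆ L → h (x ∷ J) ≡ 0ℤ) → ∑ (sublists (x ∷ L)) h ≡ ∑
  (sublists L) h
∑-sublists-∷-zero x L h e = trans (∑-sublists-∷ x L h) (trans (cong (ℤ._+_ (∑ (sublists L) h)) (∑-sublists-zero
  L e)) (ℤₚ.+-identityʳ _))

∑-sublists-∷ʳ-zero : ∀ x L (h : List ℕ → ℤ) → (∀ J → J ⊆ L → h (J ++ [ x ]) ≡ 0ℤ) → ∑ (sublists (L ++ [ x ])) h
  ≡ ∑ (sublists L) h
∑-sublists-∷ʳ-zero x L h e = trans (∑-sublists-∷ʳ x L h) (trans (cong (ℤ._+_ (∑ (sublists L) h))
  (∑-sublists-zero L e)) (ℤₚ.+-identityʳ _))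

-- A filter turned into a zero summand, so that sums over all sublists can be split element by
-- element.
ifNoConsec : (List ℕ → ℤ) → List ℕ → ℤ
ifNoConsec g J = if noConsec J then g J else 0ℤ

-- The `l` points are the l places for a domino on l + 1 cells. Leaving out the first point lays a
-- monomino; choosing it lays a domino and bars the next point.
∑-noConsec : ∀ l s g → ∑ (sublists (interval (suc s) l)) (ifNoConsec g) ≡ ∑Tiling (suc l) (g ∘ refls s)
∑-noConsec zero s g = ℤₚ.+-identityʳ _
∑-noConsec (suc zero) s g = cong (ℤ._+_ (g [])) (ℤₚ.+-identityʳ _)
∑-noConsec (suc (suc l)) s g = trans (∑-sublists-∷ (suc s) (interval (suc (suc s)) (suc l)) (ifNoConsec g))
  (cong₂ ℤ._+_ (∑-noConsec (suc l) (suc s) g) (begin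
  ∑ (sublists (interval (suc (suc s)) (suc l))) (ifNoConsec g ∘ (suc s ∷_))
    ≡⟨ ∑-sublists-∷-zero (suc (suc s)) (interval (suc (suc (suc s))) l) (ifNoConsec g ∘ (suc s ∷_))
      (λ J _ → adjacent J) ⟩
  ∑ (sublists (interval (suc (suc (suc s))) l)) (ifNoConsec g ∘ (suc s ∷_))
    ≡⟨ ∑-sublists-cong (interval (suc (suc (suc s))) l) (λ J sub → cong (λ b → if b then g (suc s ∷ J) else 0ℤ)
         (∷-noConsec (suc s) J (Subₚ.All-resp-⊆ sub (All.map proj₁ (interval-bounds (suc (suc (suc s))) l))))) ⟩
  ∑ (sublists (interval (suc (suc (suc s))) l)) (ifNoConsec (g ∘ (suc s ∷_)))
    ≡⟨ ∑-noConsec l (suc (suc s)) (g ∘ (suc s ∷_)) ⟩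
  ∑Tiling (suc l) (g ∘ (suc s ∷_) ∘ refls (suc (suc s))) ∎))
  where
  open ≡-Reasoning
  n<ᵇn : ∀ n → (n <ᵇ n) ≡ false
  n<ᵇn zero = refl
  n<ᵇn (suc n) = n<ᵇn n
  adjacent : ∀ J → ifNoConsec g (suc s ∷ suc (suc s) ∷ J) ≡ 0ℤ
  adjacent J rewrite n<ᵇn s = refl

-- Membership in the alternation set of rank r

complement : ∀ {J L} → J ⊆ L → ∃ λ K → K ⊆ L × (∀ t → alphaCoord L t ≡ alphaCoord J t ℤ.+ alphaCoord K t)
complement [] = [] , [] , λ t → refl
complement {J} (y ∷ʳ s) with complement s
... | K , sub , e = y ∷ K , refl ∷ sub , λ t → trans (cong (ℤ._+_ (simpleCoord y t)) (e t))
  (alg (simpleCoord y t) (alphaCoord J t) (alphaCoord K t))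
  where
  alg : ∀ x y z → x ℤ.+ (y ℤ.+ z) ≡ y ℤ.+ (x ℤ.+ z)
  alg = ℤ-Solver.solve-∀
complement {y ∷ J} (refl ∷ s) with complement s
... | K , sub , e = K , y ∷ʳ sub , λ t → trans (cong (ℤ._+_ (simpleCoord y t)) (e t))
  (sym (ℤₚ.+-assoc (simpleCoord y t) (alphaCoord J t) (alphaCoord K t)))

alphaCoord-partition : ∀ I L t → alphaCoord L t ≡ alphaCoord (filterᵇ I L) t ℤ.+ alphaCoord (filterᵇ (not ∘ I)
  L) t
alphaCoord-partition I [] t = refl
alphaCoord-partition I (x ∷ L) t with I x
... | true = trans (cong (ℤ._+_ (simpleCoord x t)) (alphaCoord-partition I L t))
  (sym (ℤₚ.+-assoc (simpleCoord x t) _ _))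
... | false = trans (cong (ℤ._+_ (simpleCoord x t)) (alphaCoord-partition I L t)) (alg (simpleCoord x t)
  (alphaCoord (filterᵇ I L) t) (alphaCoord (filterᵇ (not ∘ I) L) t))
  where
  alg : ∀ x y z → x ℤ.+ (y ℤ.+ z) ≡ y ℤ.+ (x ℤ.+ z)
  alg = ℤ-Solver.solve-∀

filterᵇ-⊆ : ∀ (p : ℕ → Bool) L → filterᵇ p L ⊆ L
filterᵇ-⊆ p L = Subₚ.filter-⊆ _ L

⊆-filterᵇ : ∀ (p : ℕ → Bool) {J L} → J ⊆ L → All (λ i → p i ≡ true) J → J ⊆ filterᵇ p L
⊆-filterᵇ p [] [] = []
⊆-filterᵇ p (y ∷ʳ s) hs with p y
... | true = y ∷ʳ ⊆-filterᵇ p s hs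
... | false = ⊆-filterᵇ p s hs
⊆-filterᵇ p {y ∷ _} (refl ∷ s) (h ∷ hs) with p y | h
... | true | refl = refl ∷ ⊆-filterᵇ p s hs

All-filterᵇ : ∀ (p : ℕ → Bool) {P : ℕ → Set} L → All (λ i → p i ≡ true → P i) L → All P (filterᵇ p L)
All-filterᵇ p [] [] = []
All-filterᵇ p (x ∷ L) (h ∷ hs) with p x
... | true = h refl ∷ All-filterᵇ p L hs
... | false = All-filterᵇ p L hs

alphaSet-wt : ∀ r I → alphaSet r I ≡ wt (suc r) (alphaCoord (filterᵇ I (interval 1 r)))
alphaSet-wt r I = trans (alphaList-wt r (filterᵇ I (range 1 r)))
  (cong (λ L → wt (suc r) (alphaCoord (filterᵇ I L))) (range-interval 1 r))

-- Since `J` avoids `I`, the weight θ - α_I - α_J is the sum of the simple roots outside both. That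
-- list, supplied by `complement`, is a decomposition.
inAlt-inner : ∀ r I J → J ⊆ interval 1 r → noConsec J ≡ true → All (λ i → 1 < i × i < r) J → All
  (λ i → I i ≡ false) J →
  inAlt r (prodRefl r J) (theta r) (alphaSet r I) ≡ true
inAlt-inner r I J sub nc bd off with complement (⊆-filterᵇ (not ∘ I) sub (All.map (cong not) off))
... | K , K⊆ , e = ≢0⇒0<ᵇ (subst (λ v → kostant r v ≢ 0) (sym arg) (kostant≢0 r (alphaList r K) (length K)
    (qKostant-alphaList r K (All.map (λ { (a , b) → a , ℕₚ.≤-pred b }) (Subₚ.All-resp-⊆
      (⊆-trans K⊆ (filterᵇ-⊆ (not ∘ I) (interval 1 r))) (interval-bounds 1 r))))))
  where
  alg : ∀ i j k → i ℤ.+ (j ℤ.+ k) ℤ.- i ℤ.- j ≡ k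
  alg = ℤ-Solver.solve-∀
  arg : dotArg r (prodRefl r J) (theta r) (alphaSet r I) ≡ alphaList r K
  arg = trans (cong (dotArg r (prodRefl r J) (theta r)) (alphaSet-wt r I))
    (trans (dotArg-alpha r (prodRefl r J) J (alphaCoord (filterᵇ I (interval 1 r))) (act-prodRefl-θρ r J nc bd))
      (trans (wt-cong (suc r) (λ t _ → trans (cong (λ x → x ℤ.- alphaCoord (filterᵇ I (interval 1 r)) t ℤ.-
        alphaCoord J t)
          (trans (alphaCoord-partition I (interval 1 r) t) (cong (ℤ._+_ (alphaCoord (filterᵇ I (interval 1 r))
            t)) (e t)))) (alg (alphaCoord (filterᵇ I (interval 1 r)) t) (alphaCoord J t) (alphaCoord K t))))
        (sym (alphaList-wt r K))))

-- `c` is the certificate: nonnegative on positive roots, negative on the weight. The first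
-- coordinate and minus the last coordinate are used.
inAlt-outside : ∀ r I J c → (∀ a b → a < b → b < suc r → 0ℤ ℤ.≤ dot c (root (suc r) (a , b))) → All (_≤ r) J →
  dot c (wt (suc r) (λ t → permuteBy (θρCoord r) J t ℤ.- + (r ∸ t) ℤ.- alphaCoord (filterᵇ I (interval 1 r)) t))
    ℤ.< 0ℤ →
  inAlt r (prodRefl r J) (theta r) (alphaSet r I) ≡ false
inAlt-outside r I J c pos bd neg = cong (0 <ᵇ_) (kostant-0 r _ (λ k → countDecomp-neg c (posRoots r)
  (posRoots-All r pos) _ k
  (subst (λ v → dot c v ℤ.< 0ℤ) (sym arg) neg)))
  where
  arg : dotArg r (prodRefl r J) (theta r) (alphaSet r I) ≡ wt (suc r) (λ t → permuteBy (θρCoord r) J t ℤ.- +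
    (r ∸ t) ℤ.- alphaCoord (filterᵇ I (interval 1 r)) t)
  arg = trans (cong (dotArg r (prodRefl r J) (theta r)) (alphaSet-wt r I))
    (dotArg-wt r (prodRefl r J) (permuteBy (θρCoord r) J) (alphaCoord (filterᵇ I (interval 1 r)))
      (trans (cong (act (prodRefl r J)) (θ⊕ρ r)) (act-prodRefl r (θρCoord r) J bd)))

permuteBy-fix : ∀ f J t → All (suc t <_) J → permuteBy f J t ≡ f t
permuteBy-fix f [] t [] = refl
permuteBy-fix f (suc i ∷ J) t (s≤s h ∷ hs) = trans (cong (permuteBy f J) (transposition-fix (suc i) t (ℕₚ.<⇒≢ h)
  (ℕₚ.<⇒≢ (ℕₚ.m<n⇒m<1+n h)))) (permuteBy-fix f J t hs)

-- s_1 brings the second coordinate n - 1 of `θ + ρ` to the front, where `ρ` has n and α_I has 0.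
-- The first coordinate becomes -1, while positive roots have a nonnegative one.
inAlt-first : ∀ r I J → I 1 ≡ false → noConsec (1 ∷ J) ≡ true → All (_≤ suc (suc r)) J →
  inAlt (suc (suc r)) (prodRefl (suc (suc r)) (1 ∷ J)) (theta (suc (suc r))) (alphaSet (suc (suc r)) I) ≡ false
inAlt-first r I J off nc bd = inAlt-outside (suc (suc r)) I (1 ∷ J) (δ 0) pos (s≤s z≤n ∷ bd)
  (subst (ℤ._< 0ℤ) (sym (trans (dot-δ {suc (suc (suc r))} 0 g (s≤s z≤n)) val)) ℤ.-<+)
  where
  n = suc (suc r)
  g : ℕ → ℤ
  g t = permuteBy (θρCoord n) (1 ∷ J) t ℤ.- + (n ∸ t) ℤ.- alphaCoord (filterᵇ I (interval 1 n)) t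
  pos : ∀ a b → a < b → b < suc n → 0ℤ ℤ.≤ dot (δ 0) (root (suc n) (a , b))
  pos a (suc b) l l' = subst (0ℤ ℤ.≤_) (sym (trans (dot-rootCoord (δ 0) a (suc b) l l') (ℤₚ.+-identityʳ _)))
    (δ-nonneg 0 a)
  alg : ∀ x → x ℤ.- (1ℤ ℤ.+ x) ℤ.- 0ℤ ≡ -1ℤ
  alg = ℤ-Solver.solve-∀
  val : g 0 ≡ -1ℤ
  val = trans (cong₂ (λ x y → x ℤ.- + n ℤ.- y) (trans (permuteBy-fix (θρCoord n) J 1
    (proj₁ (noConsec-∷ 1 J nc))) (θρCoord-inner (suc r) 0 (s≤s z≤n)))
    (alphaCoord-below _ (All-filterᵇ I (interval 1 n)
      (All.map (λ { {i} (h , _) on → ℕₚ.≤∧≢⇒< h (λ { refl → contradiction (trans (sym on) off) (λ ()) }) })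
      (interval-bounds 1 n)))))
    (alg (+ suc r))

permuteBy-last : ∀ f J n → All (_< suc n) J → permuteBy f (J ++ [ suc n ]) (suc n) ≡ f n
permuteBy-last f [] n [] rewrite ≢⇒≡ᵇ-false (suc n) n (ℕₚ.<⇒≢ (ℕₚ.n<1+n n) ∘ sym) | ≡ᵇ-refl n = refl
permuteBy-last f (i ∷ J) n (h ∷ hs) = trans (cong (permuteBy f (J ++ [ suc n ])) (transposition-fix i (suc n)
  (ℕₚ.<⇒≢ (ℕₚ.≤-<-trans (ℕₚ.m∸n≤m i 1) h) ∘ sym) (ℕₚ.<⇒≢ h ∘ sym))) (permuteBy-last f J n hs)

-- s_n acts first and brings the coordinate 1 to the end, where `ρ` and α_I have 0; the smaller
-- reflections do not move it again. The last coordinate becomes 1, while positive roots have none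
-- above 0.
inAlt-last : ∀ r I J → I (suc (suc r)) ≡ false → All (_< suc (suc r)) J →
  inAlt (suc (suc r)) (prodRefl (suc (suc r)) (J ++ [ suc (suc r) ])) (theta (suc (suc r)))
    (alphaSet (suc (suc r)) I) ≡ false
inAlt-last r I J off bd = inAlt-outside n I (J ++ [ n ]) (λ t → - δ n t) pos (Allₚ.++⁺ (All.map ℕₚ.<⇒≤ bd)
  (ℕₚ.≤-refl ∷ []))
  (subst (ℤ._< 0ℤ) (sym (trans (dot-neg (δ n) (wt (suc n) g)) (cong -_ (trans (dot-δ n g (ℕₚ.n<1+n n)) val))))
    ℤ.-<+)
  where
  n = suc (suc r)
  g : ℕ → ℤ
  g t = permuteBy (θρCoord n) (J ++ [ n ]) t ℤ.- + (n ∸ t) ℤ.- alphaCoord (filterᵇ I (interval 1 n)) t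
  pos : ∀ a b → a < b → b < suc n → 0ℤ ℤ.≤ dot (λ t → - δ n t) (root (suc n) (a , b))
  pos a b l l' = subst (0ℤ ℤ.≤_) (sym (trans (dot-rootCoord (λ t → - δ n t) a b l l')
    (trans (cong (λ x → - x ℤ.- - δ n b) (δ-≢ n a (ℕₚ.<⇒≢ (ℕₚ.<-≤-trans l (ℕₚ.≤-pred l')))))
      (trans (ℤₚ.+-identityˡ _) (ℤₚ.neg-involutive (δ n b)))))) (δ-nonneg n b)
  val : g n ≡ 1ℤ
  val = cong₂ (λ x y → x ℤ.- y) (cong₂ (λ x y → x ℤ.- + y) (trans (permuteBy-last (θρCoord n) J (suc r) bd)
    (trans (θρCoord-inner (suc r) r (ℕₚ.n<1+n r)) (cong +_ (trans (ℕₚ.+-∸-assoc 1 (ℕₚ.≤-refl {r}))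
    (cong suc (ℕₚ.n∸n≡0 r))))))
    (ℕₚ.n∸n≡0 r))
    (alphaCoord-above _ (All-filterᵇ I (interval 1 n) (All.map (λ { {i} (_ , s≤s h) on → ℕₚ.≤∧≢⇒< h
      (λ { refl → contradiction (trans (sym on) off) (λ ()) }) }) (interval-bounds 1 n))))

-- The three kinds of maximal interval

lhsTerm : (r a b k : ℕ) → List ℕ → ℤ
lhsTerm r a b k J = sgn (len (prodRefl r J)) ℤ.* (+ qKostant r (alphaInterval r a b ⊖ alphaList r J) k)

ifInAlt : (r : ℕ) → (ℕ → Bool) → (List ℕ → ℤ) → List ℕ → ℤ
ifInAlt r I f J = if inAlt r (prodRefl r J) (theta r) (alphaSet r I) then f J else 0ℤ

lhs-sublists : ∀ r I a b k → lhs r I a b k ≡ ∑ (sublists (range a b))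
  (ifNoConsec (ifInAlt r I (lhsTerm r a b k)))
lhs-sublists r I a b k = trans
  (∑-filterᵇ (λ J → inAlt r (prodRefl r J) (theta r) (alphaSet r I)) (lhsTerm r a b k) (filterᵇ noConsec
    (sublists (range a b))))
  (∑-filterᵇ noConsec (ifInAlt r I (lhsTerm r a b k)) (sublists (range a b)))

interval-⊆ : ∀ p l r → suc p + l ≤ r → interval (suc (suc p)) l ⊆ interval 1 r
interval-⊆ p l r h = subst (λ n → interval (suc (suc p)) l ⊆ interval 1 n) (trans (sym (ℕₚ.+-assoc (suc p) l q))
  (ℕₚ.m+[n∸m]≡n h))
  (subst (interval (suc (suc p)) l ⊆_) (sym (trans (interval-++ 1 (suc p) (l + q))
    (cong (interval 1 (suc p) ++_) (interval-++ (suc (suc p)) l q))))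
    (Subₚ.++⁺ˡ (interval 1 (suc p)) (Subₚ.++⁺ʳ (interval (suc (suc p) + l) q) ⊆-refl)))
  where
  q = r ∸ (suc p + l)

-- Away from 1 and r, `inAlt` holds for every nonconsecutive set, so `noConsec` is all that remains
-- of the two filters.
∑-interior : ∀ p l r I f → suc (suc p) + l ≤ r → (∀ i → suc p < i → i < suc (suc p) + l → I i ≡ false) →
  ∑ (sublists (interval (suc (suc p)) l)) (ifNoConsec (ifInAlt r I f)) ≡ ∑Tiling (suc l) (f ∘ refls (suc p))
∑-interior p l r I f h off = trans (∑-sublists-cong (interval (suc (suc p)) l) inner) (∑-noConsec l (suc p) f)
  where
  inner : ∀ J → J ⊆ interval (suc (suc p)) l → ifNoConsec (ifInAlt r I f) J ≡ ifNoConsec f J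
  inner J sub with noConsec J in nc
  ... | false = refl
  ... | true = cong (λ b → if b then f J else 0ℤ) (inAlt-inner r I J (⊆-trans sub (interval-⊆ p l r (ℕₚ.<⇒≤ h)))
    nc
      (All.map (λ { (a , b) → ℕₚ.≤-trans (s≤s (s≤s z≤n)) a , ℕₚ.<-≤-trans b h }) bd)
        (All.map (λ { {i} (a , b) → off i a b }) bd))
    where
    bd = Subₚ.All-resp-⊆ sub (interval-bounds (suc (suc p)) l)

ifNoConsec-zero : ∀ r I f J → (noConsec J ≡ true → inAlt r (prodRefl r J) (theta r) (alphaSet r I) ≡ false) →
  ifNoConsec (ifInAlt r I f) J ≡ 0ℤ
ifNoConsec-zero r I f J h with noConsec J
... | false = refl
... | true rewrite h refl = refl

-- `L` is the interval moved to rank N = l + 2, where its roots sum to θ_N - μ. A tiling has the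
-- same sign on both sides, and the same weight up to zero coordinates, `p` in front and `q` behind.
∑Tiling-mq : ∀ p l q a b μ L k → range a b ≡ L.map (p ℕ.+_) L → All (λ i → 1 ≤ i × i ≤ suc (suc l)) L →
  (∀ t → alphaCoord L t ≡ alphaCoord (interval 1 (suc (suc l))) t ℤ.- μ t) →
  (∀ s → 0ℤ ℤ.≤ dot (step s) (wt (suc (suc (suc l))) μ)) →
  ∑Tiling (suc l) (lhsTerm (p + (suc (suc l) + q)) a b k ∘ refls (suc p)) ≡ mq (suc (suc l))
    (theta (suc (suc l))) (wt (suc (suc (suc l))) μ) k
∑Tiling-mq p l q a b μ L k er bd eL hμ = trans (∑Tiling-cong (suc l) λ T → cong₂ (λ x y → sgn x ℤ.* + y)
    (len-prodRefl (suc p) T r (ℕₚ.≤-trans (ℕₚ.≤-reflexive (sym (ℕₚ.+-suc p (suc l)))) (ℕₚ.+-monoʳ-≤ p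
      (ℕₚ.m≤m+n (suc (suc l)) q))))
    (trans (cong (λ v → qKostant r v k) (weight T)) (qKostant-shift p (suc (suc l)) q (f T) (g T) k (lo T)
      (mid T) (hi T))))
  (sym (mq-tilings (suc l) μ k hμ))
  where
  r = p + (suc (suc l) + q)
  f g : Tiling (suc l) → ℕ → ℤ
  f T t = alphaCoord (L.map (p ℕ.+_) L) t ℤ.- alphaCoord (refls (suc p) T) t
  g T t = alphaCoord (interval 1 (suc (suc l))) t ℤ.- μ t ℤ.- alphaCoord (refls 1 T) t
  refls≡ : ∀ (T : Tiling (suc l)) → refls (suc p) T ≡ L.map (p ℕ.+_) (refls 1 T)
  refls≡ T = trans (cong (λ s → refls s T) (ℕₚ.+-comm 1 p)) (refls-+ p 1 T)
  weight : ∀ T → alphaInterval r a b ⊖ alphaList r (refls (suc p) T) ≡ wt (suc r) (f T)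
  weight T = trans (cong₂ _⊖_ (trans (alphaList-wt r (range a b)) (cong (λ is → wt (suc r) (alphaCoord is)) er))
    (alphaList-wt r (refls (suc p) T)))
    (wt-⊖ (suc r) (alphaCoord (L.map (p ℕ.+_) L)) (alphaCoord (refls (suc p) T)))
  lo : ∀ T t → t < p → f T t ≡ 0ℤ
  lo T t h = cong₂ ℤ._-_
    (alphaCoord-below _ (Allₚ.map⁺ (All.map (λ { {i} (1≤i , _) → ℕₚ.<-≤-trans (s≤s h) (subst (_≤ p + i)
      (ℕₚ.+-comm p 1) (ℕₚ.+-monoʳ-≤ p 1≤i)) }) bd)))
    (alphaCoord-below _ (All.map (λ { (l , _) → ℕₚ.<-trans (s≤s h) l }) (refls-bounds (suc p) T)))
  mid : ∀ T t → f T (p + t) ≡ g T t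
  mid T t = cong₂ ℤ._-_ (trans (alphaCoord-map-+ p L t) (eL t)) (trans (cong (λ J → alphaCoord J (p + t))
    (refls≡ T)) (alphaCoord-map-+ p (refls 1 T) t))
  hi : ∀ T t → suc (suc l) < t → g T t ≡ 0ℤ
  hi T t h = cong₂ ℤ._-_
    (trans (sym (eL t)) (alphaCoord-above L (All.map (λ { (_ , b) → ℕₚ.≤-<-trans b h }) bd)))
    (alphaCoord-above (refls 1 T) (All.map (λ { (_ , b) → ℕₚ.<-trans b h }) (refls-bounds 1 T)))

-- Dominance here means nonnegative partial sums, a property of every positive root.
simpleRoot-dominant : ∀ n i → i < n → ∀ s → 0ℤ ℤ.≤ dot (step s) (simpleRoot n (suc i))
simpleRoot-dominant n i h s = step-pos n s i (suc i) (ℕₚ.n<1+n i) (s≤s h)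

alphaCoord-dropLast : ∀ a l t → alphaCoord (interval a l) t ≡ alphaCoord (interval a (suc l)) t ℤ.- simpleCoord
  (a + l) t
alphaCoord-dropLast a l t = trans (alg (alphaCoord (interval a l) t) (simpleCoord (a + l) t))
  (cong (ℤ._- simpleCoord (a + l) t) (sym (trans (cong (λ L → alphaCoord L t) (interval-∷ʳ a l)) (alphaCoord-++
    (interval a l) [ a + l ] t))))
  where
  alg : ∀ x y → x ≡ (x ℤ.+ (y ℤ.+ 0ℤ)) ℤ.- y
  alg = ℤ-Solver.solve-∀

alphaCoord-dropFirst : ∀ a l t → alphaCoord (interval (suc a) l) t ≡ alphaCoord (interval a (suc l)) t ℤ.-
  simpleCoord a t
alphaCoord-dropFirst a l t = alg (alphaCoord (interval (suc a) l) t) (simpleCoord a t)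
  where
  alg : ∀ x y → x ≡ (y ℤ.+ x) ℤ.- y
  alg = ℤ-Solver.solve-∀

-- Here `i₁` = l + 2 is itself the rank N, so indices stay put and the offset is 0. The point 1 is
-- barred by `inAlt-first`, which leaves [2, N - 1].
lhs-initial : ∀ l q I → I 1 ≡ false → (∀ i → 1 < i → i < suc (suc l) → I i ≡ false) → ∀ k →
  lhs (suc (suc l) + q) I 1 (suc l) k ≡ mq (suc (suc l)) (theta (suc (suc l))) (simpleRoot (suc (suc l))
    (suc (suc l))) k
lhs-initial l q I off₁ off k = begin
  lhs r I 1 (suc l) k
    ≡⟨ lhs-sublists r I 1 (suc l) k ⟩
  ∑ (sublists (range 1 (suc l))) G
    ≡⟨ cong (λ R → ∑ (sublists R) G) (range-interval 1 (suc l)) ⟩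
  ∑ (sublists (interval 1 (suc l))) G
    ≡⟨ ∑-sublists-∷-zero 1 (interval 2 l) G (λ J sub → ifNoConsec-zero r I (lhsTerm r 1 (suc l) k) (1 ∷ J)
      (λ nc →
         inAlt-first (l + q) I J off₁ nc (All.map (λ { (_ , b) → ℕₚ.≤-trans (ℕₚ.<⇒≤ b) (ℕₚ.m≤m+n (suc (suc l))
           q) }) (Subₚ.All-resp-⊆ sub (interval-bounds 2 l))))) ⟩
  ∑ (sublists (interval 2 l)) G
    ≡⟨ ∑-interior 0 l r I (lhsTerm r 1 (suc l) k) (ℕₚ.m≤m+n (suc (suc l)) q) off ⟩
  ∑Tiling (suc l) (lhsTerm r 1 (suc l) k ∘ refls 1)
    ≡⟨ ∑Tiling-mq 0 l q 1 (suc l) (simpleCoord (suc (suc l))) (interval 1 (suc l)) k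
         (trans (range-interval 1 (suc l)) (sym (Lₚ.map-id (interval 1 (suc l)))))
         (All.map (λ { (a , b) → a , ℕₚ.<⇒≤ b }) (interval-bounds 1 (suc l)))
         (alphaCoord-dropLast 1 (suc l))
         (simpleRoot-dominant (suc (suc l)) (suc l) (ℕₚ.n<1+n (suc l))) ⟩
  mq (suc (suc l)) (theta (suc (suc l))) (simpleRoot (suc (suc l)) (suc (suc l))) k ∎
  where
  open ≡-Reasoning
  r = suc (suc l) + q
  G = ifNoConsec (ifInAlt r I (lhsTerm r 1 (suc l) k))

-- With j = p + 1 and i' = p + l + 2, the block [j, i'] has N = l + 2 points and is moved onto
-- [1, N]. Its end points go to 1 and N, whence α_1 + α_N.
lhs-middle : ∀ p l q I → (∀ i → suc p < i → i < suc (suc p) + l → I i ≡ false) → ∀ k →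
  lhs (p + (suc (suc l) + q)) I (suc (suc p)) (suc p + l) k
    ≡ mq (suc (suc l)) (theta (suc (suc l))) (simpleRoot (suc (suc l)) 1 ⊕ simpleRoot (suc (suc l))
      (suc (suc l))) k
lhs-middle p l q I off k = begin
  lhs r I (suc (suc p)) (suc p + l) k
    ≡⟨ lhs-sublists r I (suc (suc p)) (suc p + l) k ⟩
  ∑ (sublists (range (suc (suc p)) (suc p + l))) G
    ≡⟨ cong (λ R → ∑ (sublists R) G) range≡ ⟩
  ∑ (sublists (interval (suc (suc p)) l)) G
    ≡⟨ ∑-interior p l r I f (subst (ℕ._≤ r) (trans (ℕₚ.+-suc p (suc l)) (cong suc (ℕₚ.+-suc p l)))
      (ℕₚ.+-monoʳ-≤ p (ℕₚ.m≤m+n N q))) off ⟩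
  ∑Tiling (suc l) (f ∘ refls (suc p))
    ≡⟨ ∑Tiling-mq p l q (suc (suc p)) (suc p + l) (λ t → simpleCoord 1 t ℤ.+ simpleCoord N t) (interval 2 l) k
         (trans range≡ (trans (cong (λ a → interval a l) (ℕₚ.+-comm 2 p)) (interval-+ p 2 l)))
         (All.map (λ { (a , b) → ℕₚ.≤-trans (s≤s z≤n) a , ℕₚ.<⇒≤ b }) (interval-bounds 2 l))
         (λ t → trans (alphaCoord-dropLast 2 l t) (trans (cong (ℤ._- simpleCoord N t) (alphaCoord-dropFirst 1
           (suc l) t)) (alg (alphaCoord (interval 1 N) t) (simpleCoord 1 t) (simpleCoord N t))))
         (λ s → subst (0ℤ ℤ.≤_) (trans (sym (dot-⊕ (step s) (simpleRoot N 1) (simpleRoot N N)))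
           (cong (dot (step s)) (wt-⊕ (suc N) (simpleCoord 1) (simpleCoord N))))
           (ℤₚ.+-mono-≤ (simpleRoot-dominant N 0 (s≤s z≤n) s) (simpleRoot-dominant N (suc l) (ℕₚ.n<1+n (suc l))
             s))) ⟩
  mq N (theta N) (wt (suc N) (λ t → simpleCoord 1 t ℤ.+ simpleCoord N t)) k
    ≡⟨ cong (λ μ → mq N (theta N) μ k) (wt-⊕ (suc N) (simpleCoord 1) (simpleCoord N)) ⟨
  mq N (theta N) (simpleRoot N 1 ⊕ simpleRoot N N) k ∎
  where
  open ≡-Reasoning
  N = suc (suc l)
  r = p + (N + q)
  f = lhsTerm r (suc (suc p)) (suc p + l) k
  G = ifNoConsec (ifInAlt r I f)
  alg : ∀ x y z → x ℤ.- y ℤ.- z ≡ x ℤ.- (y ℤ.+ z)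
  alg = ℤ-Solver.solve-∀
  range≡ : range (suc (suc p)) (suc p + l) ≡ interval (suc (suc p)) l
  range≡ = trans (range-interval (suc (suc p)) (suc p + l)) (cong (interval (suc (suc p))) (ℕₚ.m+n∸m≡n p l))

-- The block [j, r] with j = p + 1 has N = l + 2 points and reaches the end of the rank, so nothing
-- is removed behind it. Dropping j leaves θ_N - α_1, and r is barred by `inAlt-last`.
lhs-final : ∀ p l I → (∀ i → suc p < i → i ≤ suc (suc p) + l → I i ≡ false) → ∀ k →
  lhs (suc (suc p) + l) I (suc (suc p)) (suc (suc p) + l) k ≡ mq (suc (suc l)) (theta (suc (suc l)))
    (simpleRoot (suc (suc l)) 1) k
lhs-final p l I off k = begin
  lhs r I (suc (suc p)) r k
    ≡⟨ lhs-sublists r I (suc (suc p)) r k ⟩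
  ∑ (sublists (range (suc (suc p)) r)) G
    ≡⟨ cong (λ R → ∑ (sublists R) G) (trans range≡ (interval-∷ʳ (suc (suc p)) l)) ⟩
  ∑ (sublists (interval (suc (suc p)) l ++ [ r ])) G
    ≡⟨ ∑-sublists-∷ʳ-zero r (interval (suc (suc p)) l) G (λ J sub → ifNoConsec-zero r I f (J ++ [ r ]) (λ _ →
         inAlt-last (p + l) I J (off r (s≤s (s≤s (ℕₚ.m≤m+n p l))) ℕₚ.≤-refl) (All.map proj₂ (Subₚ.All-resp-⊆ sub
           (interval-bounds (suc (suc p)) l))))) ⟩
  ∑ (sublists (interval (suc (suc p)) l)) G
    ≡⟨ ∑-interior p l r I f ℕₚ.≤-refl (λ i a b → off i a (ℕₚ.<⇒≤ b)) ⟩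
  ∑Tiling (suc l) (f ∘ refls (suc p))
    ≡⟨ cong (λ r' → ∑Tiling (suc l) (lhsTerm r' (suc (suc p)) r k ∘ refls (suc p))) r≡ ⟩
  ∑Tiling (suc l) (lhsTerm (p + (N + 0)) (suc (suc p)) r k ∘ refls (suc p))
    ≡⟨ ∑Tiling-mq p l 0 (suc (suc p)) r (simpleCoord 1) (interval 2 (suc l)) k
         (trans range≡ (trans (cong (λ a → interval a (suc l)) (ℕₚ.+-comm 2 p)) (interval-+ p 2 (suc l))))
         (All.map (λ { {i} (a , b) → ℕₚ.≤-trans (s≤s z≤n) a , subst (i ≤_) (ℕₚ.+-suc 1 l) (ℕₚ.≤-pred b) })
           (interval-bounds 2 (suc l)))
         (alphaCoord-dropFirst 1 (suc l))
         (simpleRoot-dominant N 0 (s≤s z≤n)) ⟩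
  mq N (theta N) (simpleRoot N 1) k ∎
  where
  open ≡-Reasoning
  N = suc (suc l)
  r = suc (suc p) + l
  f = lhsTerm r (suc (suc p)) r k
  G = ifNoConsec (ifInAlt r I f)
  r≡ : r ≡ p + (N + 0)
  r≡ = sym (trans (cong (p ℕ.+_) (ℕₚ.+-identityʳ N)) (trans (ℕₚ.+-suc p (suc l)) (cong suc (ℕₚ.+-suc p l))))
  range≡ : range (suc (suc p)) r ≡ interval (suc (suc p)) (suc l)
  range≡ = trans (range-interval (suc (suc p)) r) (cong (interval (suc (suc p)))
    (trans (cong (_∸ p) (sym (ℕₚ.+-suc p l))) (ℕₚ.m+n∸m≡n p (suc l))))

theorem4p2 : (r : ℕ) → 1 ≤ r → (I : ℕ → Bool)
    → (∀ i → I i ≡ true → 1 ≤ i × i ≤ r)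
    → ∃ (λ i → I i ≡ true)
    → ((i₁ : ℕ) → 1 < i₁ → I i₁ ≡ true → (∀ t → 1 ≤ t → t < i₁ → I t ≡ false)
         → ∀ k → lhs r I 1 (i₁ ∸ 1) k
                 ≡ mq i₁ (theta i₁) (simpleRoot i₁ i₁) k)
    × ((j i' : ℕ) → suc j < i' → I j ≡ true → I i' ≡ true
         → (∀ t → j < t → t < i' → I t ≡ false)
         → ∀ k → lhs r I (suc j) (i' ∸ 1) k
                 ≡ mq (i' ∸ j + 1) (theta (i' ∸ j + 1))
                      (simpleRoot (i' ∸ j + 1) 1 ⊕ simpleRoot (i' ∸ j + 1) (i' ∸ j + 1)) k)
    × ((j : ℕ) → j < r → I j ≡ true → (∀ t → j < t → t ≤ r → I t ≡ false)
         → ∀ k → lhs r I (suc j) r k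
                 ≡ mq (r ∸ j + 1) (theta (r ∸ j + 1)) (simpleRoot (r ∸ j + 1) 1) k)
theorem4p2 r _ I bounds _ = beforeFirst , between , afterLast
  where
  rank≡ : ∀ p l → (suc (suc p) + l) ∸ suc p + 1 ≡ suc (suc l)
  rank≡ p l = trans (cong (_+ 1) (trans (cong (_∸ p) (sym (ℕₚ.+-suc p l))) (ℕₚ.m+n∸m≡n p (suc l))))
    (ℕₚ.+-comm (suc l) 1)

  beforeFirst : (i₁ : ℕ) → 1 < i₁ → I i₁ ≡ true → (∀ t → 1 ≤ t → t < i₁ → I t ≡ false)
    → ∀ k → lhs r I 1 (i₁ ∸ 1) k ≡ mq i₁ (theta i₁) (simpleRoot i₁ i₁) k
  beforeFirst (suc (suc l)) _ on off k =
    subst (λ n → lhs n I 1 (suc l) k ≡ mq N (theta N) (simpleRoot N N) k) (ℕₚ.m+[n∸m]≡n (proj₂ (bounds N on)))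
      (lhs-initial l (r ∸ N) I (off 1 (s≤s z≤n) (s≤s (s≤s z≤n))) (λ i a b → off i (ℕₚ.<⇒≤ a) b) k)
    where
    N = suc (suc l)
  beforeFirst (suc zero) (s≤s ()) on off k

  between : (j i' : ℕ) → suc j < i' → I j ≡ true → I i' ≡ true → (∀ t → j < t → t < i' → I t ≡ false)
    → ∀ k → lhs r I (suc j) (i' ∸ 1) k ≡ mq (i' ∸ j + 1) (theta (i' ∸ j + 1))
        (simpleRoot (i' ∸ j + 1) 1 ⊕ simpleRoot (i' ∸ j + 1) (i' ∸ j + 1)) k
  between zero i' _ on = contradiction (proj₁ (bounds 0 on)) (λ ())
  -- The number `l` counts the integers strictly between `j` and `i'`.
  between (suc p) i' j+1<i' _ on off k with i' ∸ suc (suc p) | ℕₚ.m+[n∸m]≡n (ℕₚ.<⇒≤ j+1<i')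
  ... | l | refl = subst (λ N → lhs r I (suc (suc p)) (suc p + l) k ≡ mq N (theta N) (simpleRoot N 1 ⊕
    simpleRoot N N) k) (sym (rank≡ p l))
    (subst (λ n → lhs n I (suc (suc p)) (suc p + l) k ≡ mq (suc (suc l)) (theta (suc (suc l)))
      (simpleRoot (suc (suc l)) 1 ⊕ simpleRoot (suc (suc l)) (suc (suc l))) k)
      r≡ (lhs-middle p l q I off k))
    where
    q = r ∸ (suc (suc p) + l)
    r≡ : p + (suc (suc l) + q) ≡ r
    r≡ = trans (trans (ℕₚ.+-suc p (suc l + q)) (cong suc (trans (ℕₚ.+-suc p (l + q))
      (cong suc (sym (ℕₚ.+-assoc p l q))))))
      (ℕₚ.m+[n∸m]≡n (proj₂ (bounds (suc (suc p) + l) on)))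

  afterLast : (j : ℕ) → j < r → I j ≡ true → (∀ t → j < t → t ≤ r → I t ≡ false)
    → ∀ k → lhs r I (suc j) r k ≡ mq (r ∸ j + 1) (theta (r ∸ j + 1)) (simpleRoot (r ∸ j + 1) 1) k
  afterLast zero _ on = contradiction (proj₁ (bounds 0 on)) (λ ())
  -- The last interval has l + 1 points, of which `l` are available for reflections, since r is
  -- barred.
  afterLast (suc p) j<r _ off k with r ∸ suc (suc p) | ℕₚ.m+[n∸m]≡n j<r
  ... | l | refl = subst (λ N → lhs r I (suc (suc p)) r k ≡ mq N (theta N) (simpleRoot N 1) k) (sym (rank≡ p l))
    (lhs-final p l I off k)
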